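{- There exists an absolute constant $c>0$ such that the following holds for every integer $d\ge1$ and every $C\ge1$. Consider any (possibly randomized) algorithm for robust polynomial regression that, from samples with outlier chance $\rho=1/2$ (any number of samples, with points $x_i\in[-1,1]$ drawn from any distribution), returns a finite set $L$ of polynomials such that, for every real polynomial $p$ of degree at most $d$, every noise level $\sigma>0$ and every adversary, with probability at least $3/4$ at least one $\widehat p\in L$ satisfies $\|\widehat p-p\|_\infty\le C\sigma$. Then (for some choice of $p$, $\sigma$ and adversary) $$\mathbb E\left[|L|\right]\ \ge\ \tfrac34\,2^{\,c\,d/\sqrt C}.$$
   Context: $\|f\|_\infty=\sup_{x\in[-1,1]}|f(x)|$. Robust polynomial regression with outlier chance $\rho$: there is an unknown real polynomial $p$ of degree at most $d$ and a noise level $\sigma$. The points $x_i\in[-1,1]$ are drawn from some distribution; each index $i$ is an outlier independently with probability $\rho$ (independently of the points). An adversary, seeing $p$, the points and the set of outliers, then picks $y_i\in\mathbb R$ subject only to $|y_i-p(x_i)|\le\sigma$ for each non-outlier $i$. The algorithm sees only the samples $(x_i,y_i)$ (it may know $d,C,\sigma$ and the distribution of the points). A $C$-approximation to $p$ is a $\widehat p$ with $\|\widehat p-p\|_\infty\le C\sigma$. -}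

module Defs where

open import Level using (0ℓ) renaming (suc to lsuc)
open import Algebra.Structures using (IsCommutativeRing)
open import Axiom.ExcludedMiddle using (ExcludedMiddle)
open import Data.Bool using (Bool; true; false; if_then_else_)
open import Data.Fin using (Fin)
open import Data.List as List using (List; []; _∷_)
open import Data.List.Relation.Unary.Any using (Any)
open import Data.Nat as ℕ using (ℕ; zero; suc)
open import Data.Product using (Σ; ∃; _×_; _,_; proj₁; proj₂)
open import Data.Sum using (inj₁; inj₂)
open import Data.Vec as Vec using (Vec; lookup; zip)
open import Function using (_∘_)
open import Relation.Binary.Bundles using (Setoid)
open import Relation.Binary.PropositionalEquality
  using (_≡_; _≢_; refl; sym; trans)
open import Relation.Binary.Structures using (IsTotalOrder)
open import Relation.Nullary using (yes; no)
open import Relation.Unary using (Pred; U; ∁; ⋃; _∩_; _⊥_; _≐_; _⊢_)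
import Data.List.Relation.Unary.Unique.Setoid as UniqueSetoid

-- The real numbers enter as an arbitrary (Dedekind-)complete ordered
-- field; classically this is ℝ up to unique isomorphism.

record CompleteOrderedField : Set₁ where
  infixl 6 _+_
  infixl 7 _*_
  infix  8 -_
  infix  9 _⁻¹
  infix  4 _≤_
  field
    ℝ                 : Set
    _+_ _*_           : ℝ → ℝ → ℝ
    -_                : ℝ → ℝ
    0# 1#             : ℝ
    _⁻¹               : ℝ → ℝ          -- the value 0# ⁻¹ is unconstrained
    _≤_               : ℝ → ℝ → Set
    isCommutativeRing : IsCommutativeRing _≡_ _+_ _*_ -_ 0# 1#
    0≢1               : 0# ≢ 1#
    *-inverse         : ∀ x → x ≢ 0# → x * x ⁻¹ ≡ 1#
    isTotalOrder      : IsTotalOrder _≡_ _≤_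
    +-monoˡ-≤         : ∀ {x y} z → x ≤ y → x + z ≤ y + z
    *-nonNeg          : ∀ {x y} → 0# ≤ x → 0# ≤ y → 0# ≤ x * y

  IsUpperBound : Pred ℝ 0ℓ → ℝ → Set
  IsUpperBound S b = ∀ x → S x → x ≤ b

  IsLub : Pred ℝ 0ℓ → ℝ → Set
  IsLub S s = IsUpperBound S s × (∀ b → IsUpperBound S b → s ≤ b)

  field
    complete : ∀ S → ∃ S → ∃ (IsUpperBound S) → ∃ (IsLub S)

record MeasurableSpace : Set₂ where
  field
    Carrier    : Set
    Measurable : Pred Carrier 0ℓ → Set₁
    resp-≐     : ∀ {A B} → A ≐ B → Measurable A → Measurable B
    univ       : Measurable U
    compl      : ∀ {A} → Measurable A → Measurable (∁ A)
    union      : ∀ {A : ℕ → Pred Carrier 0ℓ} →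
                 (∀ i → Measurable (A i)) → Measurable (⋃ ℕ A)

open MeasurableSpace using (Carrier; Measurable)

data Generated {X : Set} (G : Pred X 0ℓ → Set₁) : Pred X 0ℓ → Set₁ where
  base   : ∀ {A} → G A → Generated G A
  resp-≐ : ∀ {A B} → A ≐ B → Generated G A → Generated G B
  univ   : Generated G U
  compl  : ∀ {A} → Generated G A → Generated G (∁ A)
  union  : ∀ {A : ℕ → Pred X 0ℓ} →
           (∀ i → Generated G (A i)) → Generated G (⋃ ℕ A)

σ⟨_⟩ : {X : Set} → (Pred X 0ℓ → Set₁) → MeasurableSpace
σ⟨_⟩ {X} G = record
  { Carrier    = X
  ; Measurable = Generated G
  ; resp-≐     = resp-≐
  ; univ       = univ
  ; compl      = compl
  ; union      = union
  }

data Singletons (X : Set) : Pred X 0ℓ → Set₁ where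
  singleton : ∀ x → Singletons X (_≡ x)

Boolᵐ : MeasurableSpace
Boolᵐ = σ⟨ Singletons Bool ⟩

data Cylinders (M N : MeasurableSpace) :
               Pred (Carrier M × Carrier N) 0ℓ → Set₁ where
  fst : ∀ {A} → Measurable M A → Cylinders M N (proj₁ ⊢ A)
  snd : ∀ {B} → Measurable N B → Cylinders M N (proj₂ ⊢ B)

infixr 2 _⊗_
_⊗_ : MeasurableSpace → MeasurableSpace → MeasurableSpace
M ⊗ N = σ⟨ Cylinders M N ⟩

data VecCylinders (M : MeasurableSpace) (n : ℕ) :
                  Pred (Vec (Carrier M) n) 0ℓ → Set₁ where
  coord : ∀ {A} (i : Fin n) → Measurable M A →
          VecCylinders M n ((λ v → lookup v i) ⊢ A)

Vecᵐ : MeasurableSpace → ℕ → MeasurableSpace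
Vecᵐ M n = σ⟨ VecCylinders M n ⟩

IsMeasurable : (M N : MeasurableSpace) → (Carrier M → Carrier N) → Set₁
IsMeasurable M N f = ∀ {B} → Measurable N B → Measurable M (f ⊢ B)

module Regression (em : ExcludedMiddle 0ℓ) (R : CompleteOrderedField) where

  open CompleteOrderedField R public
  open IsTotalOrder isTotalOrder using (total)

  infix  4 _<_
  infixl 6 _-_
  infixl 7 _/_

  _<_ : ℝ → ℝ → Set
  x < y = x ≤ y × x ≢ y

  _-_ : ℝ → ℝ → ℝ
  x - y = x + - y

  _/_ : ℝ → ℝ → ℝ
  x / y = x * y ⁻¹

  ∣_∣ : ℝ → ℝ
  ∣ x ∣ with total 0# x
  ... | inj₁ _ = x
  ... | inj₂ _ = - x

  fromℕ : ℕ → ℝ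
  fromℕ zero    = 0#
  fromℕ (suc n) = 1# + fromℕ n

  ½ ¾ : ℝ
  ½ = 1# / fromℕ 2
  ¾ = fromℕ 3 / fromℕ 4

  infixr 8 _^_
  _^_ : ℝ → ℕ → ℝ
  x ^ zero  = 1#
  x ^ suc n = x * x ^ n

  ∑< : ℕ → (ℕ → ℝ) → ℝ
  ∑< zero    f = 0#
  ∑< (suc n) f = ∑< n f + f n

  -- The supremum, with the junk value 0# for sets that have none.
  sup : Pred ℝ 0ℓ → ℝ
  sup S with em {∃ (IsLub S)}
  ... | yes (s , _) = s
  ... | no  _       = 0#

  √_ : ℝ → ℝ
  √ x = sup (λ y → y * y ≤ x)

  -- 2^x is the supremum of the rational powers y = 2^((m-k)/n) with
  -- (m-k)/n ≤ x.
  2^_ : ℝ → ℝ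
  2^ x = sup (λ y → Σ ℕ λ m → Σ ℕ λ k → Σ ℕ λ n →
    1 ℕ.≤ n × fromℕ m - fromℕ k ≤ fromℕ n * x ×
    0# < y × y ^ n * fromℕ 2 ^ k ≡ fromℕ 2 ^ m)

  data ℝ∞ : Set where
    fin : ℝ → ℝ∞
    ∞   : ℝ∞

  infix 4 _≤∞_
  data _≤∞_ : ℝ∞ → ℝ∞ → Set where
    fin≤fin : ∀ {x y} → x ≤ y → fin x ≤∞ fin y
    ≤top    : ∀ {x} → x ≤∞ ∞

  Range : (ℕ → ℝ) → Pred ℝ 0ℓ
  Range u x = ∃ λ n → x ≡ u n

  -- Sum of a series of nonnegative terms.
  ∑∞ : (ℕ → ℝ) → ℝ∞
  ∑∞ f with em {∃ (IsUpperBound (Range (λ n → ∑< n f)))}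
  ... | yes _ = fin (sup (Range (λ n → ∑< n f)))
  ... | no  _ = ∞

  In[-1,1] : Pred ℝ 0ℓ
  In[-1,1] x = - 1# ≤ x × x ≤ 1#

  ‖_‖∞ : (ℝ → ℝ) → ℝ
  ‖ f ‖∞ = sup (λ y → ∃ λ x → In[-1,1] x × y ≡ ∣ f x ∣)

  -- Polynomials are coefficient lists, constant term first, identified
  -- when they differ only by trailing zeros

  Poly : Set
  Poly = List ℝ

  coeff : Poly → ℕ → ℝ
  coeff []      _       = 0#
  coeff (a ∷ _) zero    = a
  coeff (_ ∷ p) (suc i) = coeff p i

  eval : Poly → ℝ → ℝ
  eval p x = List.foldr (λ a r → a + x * r) 0# p

  Degree≤ : ℕ → Poly → Set
  Degree≤ d p = ∀ i → d ℕ.< i → coeff p i ≡ 0#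

  polySetoid : Setoid 0ℓ 0ℓ
  polySetoid = record
    { Carrier       = Poly
    ; _≈_           = λ p q → ∀ i → coeff p i ≡ coeff q i
    ; isEquivalence = record
      { refl  = λ _ → refl
      ; sym   = λ e i → sym (e i)
      ; trans = λ e f i → trans (e i) (f i)
      }
    }

  record FinitePolySet : Set where
    field
      elements : List Poly
      distinct : UniqueSetoid.Unique polySetoid elements

    card : ℕ
    card = List.length elements

  open FinitePolySet public

  ContainsApprox : FinitePolySet → Poly → ℝ → Set
  ContainsApprox L p r =
    Any (λ q → ‖ (λ x → eval q x - eval p x) ‖∞ ≤ r) (elements L)

  data Rays : Pred ℝ 0ℓ → Set₁ where
    ray : ∀ a → Rays (_≤ a)

  Borel : MeasurableSpace
  Borel = σ⟨ Rays ⟩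

  -- prob is constrained, and meaningful, on measurable sets only.  For
  -- nonnegative terms the sum of a series is the least upper bound of
  -- its partial sums.
  record ProbabilitySpace : Set₂ where
    field
      space    : MeasurableSpace
    open MeasurableSpace space public
      using () renaming (Carrier to Ω; Measurable to Event)
    field
      prob     : Pred Ω 0ℓ → ℝ
      cong-≐   : ∀ {A B} → Event A → A ≐ B → prob A ≡ prob B
      nonNeg   : ∀ {A} → Event A → 0# ≤ prob A
      total≡1  : prob U ≡ 1#
      additive : ∀ {A : ℕ → Pred Ω 0ℓ} → (∀ i → Event (A i)) →
                 (∀ {i j} → i ≢ j → A i ⊥ A j) →
                 IsLub (Range (λ n → ∑< n (prob ∘ A))) (prob (⋃ ℕ A))

    Independent : (M N : MeasurableSpace) →
                  (Ω → Carrier M) → (Ω → Carrier N) → Set₁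
    Independent M N f g = ∀ {A B} → Measurable M A → Measurable N B →
      prob ((f ⊢ A) ∩ (g ⊢ B)) ≡ prob (f ⊢ A) * prob (g ⊢ B)

    𝔼 : (Ω → ℕ) → ℝ∞
    𝔼 N = ∑∞ (λ k → fromℕ k * prob (N ⊢ (_≡ k)))

  bernoulli : ∀ {n} → ℝ → Vec Bool n → ℝ
  bernoulli ρ o =
    Vec.foldr′ (λ b w → (if b then ρ else 1# - ρ) * w) 1# o

  -- Everything random: the n points, which of the indices are outliers
  -- (true), and the internal randomness of the algorithm.  The joint law
  -- of the points is arbitrary; i.i.d. points are a special case.
  record Experiment (ρ : ℝ) (n : ℕ) : Set₂ where
    field
      probabilitySpace : ProbabilitySpace
      Seed             : MeasurableSpace
    open ProbabilitySpace probabilitySpace public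
    field
      points           : Ω → Vec ℝ n
      outlier          : Ω → Vec Bool n
      seed             : Ω → Carrier Seed
      points-meas      : IsMeasurable space (Vecᵐ Borel n) points
      outlier-meas     : IsMeasurable space (Vecᵐ Boolᵐ n) outlier
      seed-meas        : IsMeasurable space Seed seed
      points-range     : ∀ ω i → In[-1,1] (lookup (points ω) i)
      outlier-law      : ∀ o → prob (outlier ⊢ (_≡ o)) ≡ bernoulli ρ o
      -- Together these two say that points, outlier and seed are
      -- mutually independent.
      points⊥seed      : Independent (Vecᵐ Borel n) Seed points seed
      outlier⊥rest     : Independent (Vecᵐ Boolᵐ n) (Vecᵐ Borel n ⊗ Seed)
                           outlier (λ ω → points ω , seed ω)

  -- run receives the noise level, the samples and the random seed.  Its
  -- output is measurable in the weak sense that the events below are.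
  record Algorithm (n : ℕ) (Seed : MeasurableSpace) : Set₁ where
    Input : MeasurableSpace
    Input = Vecᵐ (Borel ⊗ Borel) n ⊗ Seed
    field
      run         : ℝ → Vec (ℝ × ℝ) n → Carrier Seed → FinitePolySet
      approx-meas : ∀ σ p r → Measurable Input
                      (λ (s , w) → ContainsApprox (run σ s w) p r)
      card-meas   : ∀ σ k → Measurable Input
                      (λ (s , w) → card (run σ s w) ≡ k)

  record Adversary (p : Poly) (σ : ℝ) (n : ℕ) : Set₁ where
    field
      values      : Vec ℝ n × Vec Bool n → Vec ℝ n
      values-meas : IsMeasurable (Vecᵐ Borel n ⊗ Vecᵐ Boolᵐ n)
                      (Vecᵐ Borel n) values
      inlier      : ∀ xs o → (∀ i → In[-1,1] (lookup xs i)) →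
                    ∀ i → lookup o i ≡ false →
                    ∣ lookup (values (xs , o)) i - eval p (lookup xs i) ∣ ≤ σ

  module _ {ρ n} (E : Experiment ρ n) where
    open Experiment E
    open Algorithm
    open Adversary

    output : Algorithm n Seed → ∀ {p σ} → Adversary p σ n →
             Ω → FinitePolySet
    output alg {σ = σ} adv ω = run alg σ (zip xs ys) (seed ω)
      where
      xs = points ω
      ys = values adv (xs , outlier ω)

    successProbability : ℝ → Algorithm n Seed →
                         ∀ {p σ} → Adversary p σ n → ℝ
    successProbability C alg {p} {σ} adv =
      prob (λ ω → ContainsApprox (output alg adv ω) p (C * σ))

    expectedSize : Algorithm n Seed → ∀ {p σ} → Adversary p σ n → ℝ∞
    expectedSize alg adv = 𝔼 (λ ω → card (output alg adv ω))

{-# OPTIONS --safe #-}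
module Submission where

-- At a fixed degree there is a family of 2^m polynomials, m ~ d/√C, that
-- pairwise differ by more than 2Cσ somewhere, yet at every point of [-1,1]
-- take only two values up to σ.  The adversary lets an outlier report the
-- value that the true polynomial does not take, so that every y is a fair
-- coin flip between the two: the law of the samples does not depend on the
-- member of the family.  Hence under one and the same law each member is
-- approximated by the list with probability at least 3/4, while no
-- polynomial approximates two members, so the expected size of the list is
-- at least 3/4 · 2^m.
--
-- The family consists of the subset sums of m spikes 2^k h^(k+1), where the h
-- are the Fejér kernels of Hermite-Fejér interpolation at the Chebyshev
-- nodes: they are nonnegative with sum 1, and each is 1 at its node, so at
-- most one exceeds 1/2 and a high power suppresses all the others.

open import Defs
open import Level using (0ℓ)
open import Algebra.Bundles using (CommutativeRing; RawRing)
import Algebra.Properties.AbelianGroup as AbelianGroupProperties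
import Algebra.Properties.Ring as RingProperties
import Algebra.Solver.Ring
open import Algebra.Solver.Ring.AlmostCommutativeRing
  using (AlmostCommutativeRing; fromCommutativeRing; _-Raw-AlmostCommutative⟶_)
open import Axiom.ExcludedMiddle using (ExcludedMiddle)
open import Data.Bool using (Bool; true; false; _xor_; if_then_else_)
import Data.Bool.Properties as Boolₚ
open import Data.Empty using (⊥-elim)
open import Data.Fin using (Fin; zero; suc)
open import Data.List as List using (List; []; _∷_; length; _++_)
open import Data.List.Membership.Propositional using (_∈_)
import Data.List.Properties as Listₚ
open import Data.List.Relation.Unary.All as All using (All; []; _∷_)
import Data.List.Relation.Unary.All.Properties as Allₚ
open import Data.List.Relation.Unary.AllPairs as AllPairs using (AllPairs; []; _∷_)
import Data.List.Relation.Unary.AllPairs.Properties as AllPairsₚ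
open import Data.List.Relation.Unary.Any using (Any; here; there)
open import Data.Maybe using (Maybe; just; nothing)
open import Data.Nat as ℕ using (ℕ; zero; suc; z≤n; s≤s)
import Data.Nat.Properties as ℕₚ
open import Data.Product using (Σ; ∃; _×_; _,_; proj₁; proj₂)
open import Data.Sum using (_⊎_; inj₁; inj₂; [_,_]′)
open import Data.Vec as Vec using (Vec; []; _∷_; lookup; zip; zipWith)
import Data.Vec.Properties as Vecₚ
open import Function using (_∘_)
open import Relation.Binary.PropositionalEquality
open import Relation.Binary.Structures using (IsTotalOrder)
open import Relation.Nullary using (¬_; Dec; yes; no; does)
open import Relation.Unary using (Pred; ∁; ⋃; _∩_; _∪_; _⊥_; _≐_; _⊢_; ∅)

-- The obstacle is measurability. The second value at x, and the side on which a member lies, are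
-- extracted from existentials and excluded middle, while an adversary must be a measurable function
-- of the points. Hence every such choice is made at a grid point near x: a function that takes
-- finitely many values, each on a Borel set, stays measurable whatever is composed with it. A
-- common Lipschitz constant of the family keeps the rounding error at most 1; with the width 1 of
-- the two bands this gives noise level 2. The side depends on the point, so the flips of the coins
-- do as well, and equality of the laws rests on the independence of the outliers from points and
-- seed together. The reals are a bare complete ordered field, so the Chebyshev nodes come from
-- half-angle square roots instead of cosines. Their number is then a power of two, and the Fejér
-- identities become inductions by angle doubling. The exponent k is linear in √C, so that 2^k
-- exceeds 4C; it multiplies the degree, which is the origin of √C in m.

module Reals (em : ExcludedMiddle 0ℓ) (R : CompleteOrderedField) where
  open Regression em R

  -- Arithmetic, powers and suprema in a complete ordered field.

  ring : CommutativeRing 0ℓ 0ℓ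
  ring = record { isCommutativeRing = isCommutativeRing }

  private
    module K = CommutativeRing ring
    module RP = RingProperties K.ring
    module GP = AbelianGroupProperties K.+-abelianGroup
  open IsTotalOrder isTotalOrder public using (total)
    renaming (refl to ≤-refl; trans to ≤-trans; antisym to ≤-antisym; reflexive to ≤-reflexive)

  fromℕ-+ : ∀ a b → fromℕ (a ℕ.+ b) ≡ fromℕ a + fromℕ b
  fromℕ-+ zero    b = sym (K.+-identityˡ _)
  fromℕ-+ (suc a) b = trans (cong (1# +_) (fromℕ-+ a b)) (sym (K.+-assoc _ _ _))

  fromℕ-* : ∀ a b → fromℕ (a ℕ.* b) ≡ fromℕ a * fromℕ b
  fromℕ-* zero    b = sym (K.zeroˡ _)
  fromℕ-* (suc a) b = trans (fromℕ-+ b (a ℕ.* b))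
    (trans (cong₂ _+_ (sym (K.*-identityˡ _)) (fromℕ-* a b)) (sym (K.distribʳ _ _ _)))

  -- The ring solver works with integer coefficients, written as formal
  -- differences (a , b) of natural numbers.
  private
    Coeff : RawRing 0ℓ 0ℓ
    Coeff = record
      { Carrier = ℕ × ℕ
      ; _≈_     = _≡_
      ; _+_     = λ (a , b) (c , d) → a ℕ.+ c , b ℕ.+ d
      ; _*_     = λ (a , b) (c , d) → a ℕ.* c ℕ.+ b ℕ.* d , a ℕ.* d ℕ.+ b ℕ.* c
      ; -_      = λ (a , b) → b , a
      ; 0#      = 0 , 0
      ; 1#      = 1 , 0
      }

    -- Ends in `1#` where `fromℕ` ends in `1# + 0#`, so that the solver constants `:0` and `:1`
    -- denote `0#` and `1#` definitionally.
    numeral : ℕ → ℝ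
    numeral zero          = 0#
    numeral (suc zero)    = 1#
    numeral (suc (suc n)) = 1# + numeral (suc n)

    ⟦_⟧ᶜ : ℕ × ℕ → ℝ
    ⟦ a , zero ⟧ᶜ      = numeral a
    ⟦ zero , suc b ⟧ᶜ  = - numeral (suc b)
    ⟦ suc a , suc b ⟧ᶜ = ⟦ a , b ⟧ᶜ

    difference : ℕ × ℕ → ℝ
    difference (a , b) = fromℕ a - fromℕ b

    difference-cong : ∀ a b c d → a ℕ.+ d ≡ c ℕ.+ b → difference (a , b) ≡ difference (c , d)
    difference-cong a b c d e = GP.∙-cancelʳ (fromℕ b + fromℕ d) _ _ (begin
      (fromℕ a - fromℕ b) + (fromℕ b + fromℕ d) ≡⟨ cancel (fromℕ a) (fromℕ b) (fromℕ d) ⟩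
      fromℕ a + fromℕ d                         ≡⟨ fromℕ-+ a d ⟨
      fromℕ (a ℕ.+ d)                           ≡⟨ cong fromℕ e ⟩
      fromℕ (c ℕ.+ b)                           ≡⟨ fromℕ-+ c b ⟩
      fromℕ c + fromℕ b                         ≡⟨ cancel (fromℕ c) (fromℕ d) (fromℕ b) ⟨
      (fromℕ c - fromℕ d) + (fromℕ d + fromℕ b) ≡⟨ cong ((fromℕ c - fromℕ d) +_) (K.+-comm _ _) ⟩
      (fromℕ c - fromℕ d) + (fromℕ b + fromℕ d) ∎)
      where
      open ≡-Reasoning
      cancel : ∀ x y z → (x - y) + (y + z) ≡ x + z
      cancel x y z = trans (K.+-assoc x _ _) (cong (x +_)
        (trans (sym (K.+-assoc (- y) y z))
          (trans (cong (_+ z) (K.-‿inverseˡ y)) (K.+-identityˡ z))))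

    numeral≡fromℕ : ∀ n → numeral n ≡ fromℕ n
    numeral≡fromℕ zero          = refl
    numeral≡fromℕ (suc zero)    = sym (K.+-identityʳ _)
    numeral≡fromℕ (suc (suc n)) = cong (1# +_) (numeral≡fromℕ (suc n))

    ⟦⟧≡ : ∀ p → ⟦ p ⟧ᶜ ≡ difference p
    ⟦⟧≡ (a , zero)  = trans (numeral≡fromℕ a)
      (sym (trans (cong (fromℕ a +_) RP.-0#≈0#) (K.+-identityʳ _)))
    ⟦⟧≡ (zero , suc b)  = trans (cong -_ (numeral≡fromℕ (suc b))) (sym (K.+-identityˡ _))
    ⟦⟧≡ (suc a , suc b) = trans (⟦⟧≡ (a , b)) (difference-cong a b (suc a) (suc b) (ℕₚ.+-suc a b))

    interchange : ∀ a b c d → (a + b) + (c + d) ≡ (a + c) + (b + d)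
    interchange a b c d = trans (K.+-assoc a b _)
      (trans (cong (a +_) (trans (sym (K.+-assoc b c d))
        (trans (cong (_+ d) (K.+-comm b c)) (K.+-assoc c b d))))
        (sym (K.+-assoc a c _)))

    difference-+ : ∀ p q → difference (RawRing._+_ Coeff p q) ≡ difference p + difference q
    difference-+ (a , b) (c , d) = trans
      (cong₂ _-_ (fromℕ-+ a c) (fromℕ-+ b d))
      (trans (cong ((fromℕ a + fromℕ c) +_) (sym (GP.⁻¹-∙-comm _ _)))
        (interchange _ _ _ _))

    product-of-differences : ∀ a b c d →
      (a * c + b * d) - (a * d + b * c) ≡ (a - b) * (c - d)
    product-of-differences a b c d = sym (trans (K.distribʳ _ _ _)
      (trans (cong₂ _+_ (K.distribˡ _ _ _) (K.distribˡ _ _ _))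
      (trans (cong₂ (λ u v → (a * c + u) + v) (sym (RP.-‿distribʳ-* a d))
               (trans (K.+-comm _ _) (cong₂ _+_
                 (trans (sym (RP.-‿distribˡ-* b (- d)))
                   (trans (cong -_ (sym (RP.-‿distribʳ-* b d))) (GP.⁻¹-involutive _)))
                 (sym (RP.-‿distribˡ-* b c)))))
      (trans (interchange _ _ _ _)
        (cong ((a * c + b * d) +_) (GP.⁻¹-∙-comm _ _))))))

    difference-* : ∀ p q → difference (RawRing._*_ Coeff p q) ≡ difference p * difference q
    difference-* (a , b) (c , d) = trans
      (cong₂ _-_ (trans (fromℕ-+ (a ℕ.* c) _) (cong₂ _+_ (fromℕ-* a c) (fromℕ-* b d)))
                 (trans (fromℕ-+ (a ℕ.* d) _) (cong₂ _+_ (fromℕ-* a d) (fromℕ-* b c))))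
      (product-of-differences _ _ _ _)

    difference-neg : ∀ p → difference (RawRing.-_ Coeff p) ≡ - difference p
    difference-neg (a , b) = trans (K.+-comm _ _)
      (trans (cong (- fromℕ a +_) (sym (GP.⁻¹-involutive _))) (GP.⁻¹-∙-comm _ _))

    target : AlmostCommutativeRing 0ℓ 0ℓ
    target = fromCommutativeRing ring

    morphism : Coeff -Raw-AlmostCommutative⟶ target
    morphism = record
      { ⟦_⟧    = ⟦_⟧ᶜ
      ; +-homo = λ p q → trans (⟦⟧≡ (RawRing._+_ Coeff p q))
          (trans (difference-+ p q) (sym (cong₂ _+_ (⟦⟧≡ p) (⟦⟧≡ q))))
      ; *-homo = λ p q → trans (⟦⟧≡ (RawRing._*_ Coeff p q))
          (trans (difference-* p q) (sym (cong₂ _*_ (⟦⟧≡ p) (⟦⟧≡ q))))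
      ; -‿homo = λ p → trans (⟦⟧≡ (RawRing.-_ Coeff p))
          (trans (difference-neg p) (sym (cong -_ (⟦⟧≡ p))))
      ; 0-homo = refl
      ; 1-homo = refl
      }

    _≟ᶜ_ : ∀ p q → Maybe (⟦ p ⟧ᶜ ≡ ⟦ q ⟧ᶜ)
    p@(a , b) ≟ᶜ q@(c , d) with a ℕ.+ d ℕ.≟ c ℕ.+ b
    ... | yes e = just (trans (⟦⟧≡ p) (trans (difference-cong a b c d e) (sym (⟦⟧≡ q))))
    ... | no _  = nothing

    module Solver = Algebra.Solver.Ring Coeff target morphism _≟ᶜ_

  open Solver public using (solve; _:+_; _:*_; :-_; _:-_; _:=_; con; Polynomial)

  :0 :1 : ∀ {n} → Polynomial n
  :0 = con (0 , 0)
  :1 = con (1 , 0)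

  +-identityʳ = K.+-identityʳ
  +-identityˡ = K.+-identityˡ
  +-comm = K.+-comm
  +-assoc = K.+-assoc
  *-comm = K.*-comm
  *-assoc = K.*-assoc
  *-identityˡ = K.*-identityˡ
  *-identityʳ = K.*-identityʳ
  zeroˡ = K.zeroˡ
  zeroʳ = K.zeroʳ

  ≤⇒0≤ : ∀ {x y} → x ≤ y → 0# ≤ y - x
  ≤⇒0≤ {x} {y} p = subst (_≤ y - x) (K.-‿inverseʳ x) (+-monoˡ-≤ (- x) p)

  0≤⇒≤ : ∀ {x y} → 0# ≤ y - x → x ≤ y
  0≤⇒≤ {x} {y} p = subst₂ _≤_ (+-identityˡ x)
    (solve 2 (λ x y → (y :- x) :+ x := y) refl x y) (+-monoˡ-≤ x p)

  -- Linear inequalities are proved by exhibiting the slack t of the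
  -- conclusion as a sum of slacks of the hypotheses.
  slack : ∀ {x y t} → 0# ≤ t → y - x ≡ t → x ≤ y
  slack p e = 0≤⇒≤ (subst (0# ≤_) (sym e) p)

  +-mono-≤ : ∀ {a b c d} → a ≤ b → c ≤ d → a + c ≤ b + d
  +-mono-≤ {a} {b} {c} {d} p q = ≤-trans (+-monoˡ-≤ c p)
    (subst₂ _≤_ (+-comm c b) (+-comm d b) (+-monoˡ-≤ b q))

  0≤+ : ∀ {a b} → 0# ≤ a → 0# ≤ b → 0# ≤ a + b
  0≤+ {a} {b} p q = subst (_≤ a + b) (+-identityˡ 0#) (+-mono-≤ p q)

  x≤y+x : ∀ {x y} → 0# ≤ y → x ≤ y + x
  x≤y+x {x} {y} 0≤y = slack 0≤y (solve 2 (λ x y → (y :+ x) :- x := y) refl x y)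

  x≤x+y : ∀ {x y} → 0# ≤ y → x ≤ x + y
  x≤x+y {x} {y} 0≤y = ≤-trans (x≤y+x 0≤y) (≤-reflexive (+-comm y x))

  neg-mono-≤ : ∀ {a b} → a ≤ b → - b ≤ - a
  neg-mono-≤ {a} {b} p = slack (≤⇒0≤ p)
    (solve 2 (λ a b → (:- a) :- (:- b) := b :- a) refl a b)

  *-monoˡ-≤ : ∀ {a b} c → 0# ≤ c → a ≤ b → c * a ≤ c * b
  *-monoˡ-≤ {a} {b} c 0≤c p = slack (*-nonNeg 0≤c (≤⇒0≤ p))
    (solve 3 (λ a b c → c :* b :- c :* a := c :* (b :- a)) refl a b c)

  *-mono-≤ : ∀ {a b c d} → 0# ≤ a → 0# ≤ c → a ≤ b → c ≤ d → a * c ≤ b * d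
  *-mono-≤ {a} {b} {c} {d} 0≤a 0≤c p q = ≤-trans (*-monoˡ-≤ a 0≤a q)
    (subst₂ _≤_ (*-comm d a) (*-comm d b) (*-monoˡ-≤ d (≤-trans 0≤c q) p))

  0≤x² : ∀ x → 0# ≤ x * x
  0≤x² x with total 0# x
  ... | inj₁ p = *-nonNeg p p
  ... | inj₂ p = subst (0# ≤_) (solve 1 (λ x → (:- x) :* (:- x) := x :* x) refl x)
                   (*-nonNeg 0≤-x 0≤-x)
    where
    0≤-x : 0# ≤ - x
    0≤-x = slack (≤⇒0≤ p) (solve 1 (λ x → (:- x) :- :0 := :0 :- x) refl x)

  0≤1 : 0# ≤ 1#
  0≤1 = subst (0# ≤_) (*-identityˡ 1#) (0≤x² 1#)

  0<1 : 0# < 1#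
  0<1 = 0≤1 , 0≢1

  0≤fromℕ : ∀ n → 0# ≤ fromℕ n
  0≤fromℕ zero    = ≤-refl
  0≤fromℕ (suc n) = 0≤+ 0≤1 (0≤fromℕ n)

  fromℕ-mono : ∀ {a b} → a ℕ.≤ b → fromℕ a ≤ fromℕ b
  fromℕ-mono {b = b} ℕ.z≤n = 0≤fromℕ b
  fromℕ-mono (ℕ.s≤s p)     = +-mono-≤ ≤-refl (fromℕ-mono p)

  ≮⇒≥ : ∀ {x y} → ¬ (x ≤ y) → y ≤ x
  ≮⇒≥ {x} {y} p with total x y
  ... | inj₁ q = ⊥-elim (p q)
  ... | inj₂ q = q

  <⇒≱ : ∀ {x y} → x < y → ¬ (y ≤ x)
  <⇒≱ (p , n) q = n (≤-antisym p q)

  ≱⇒< : ∀ {x y} → ¬ (y ≤ x) → x < y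
  ≱⇒< p = ≮⇒≥ p , λ { refl → p ≤-refl }

  ≤-<-trans : ∀ {x y z} → x ≤ y → y < z → x < z
  ≤-<-trans p (q , n) = ≤-trans p q , λ { refl → n (≤-antisym q p) }

  <-≤-trans : ∀ {x y z} → x < y → y ≤ z → x < z
  <-≤-trans (p , n) q = ≤-trans p q , λ { refl → n (≤-antisym p q) }

  0<2 : 0# < 1# + 1#
  0<2 = <-≤-trans 0<1 (x≤x+y 0≤1)

  ⁻¹-cancelˡ : ∀ {c} → 0# < c → ∀ z → c ⁻¹ * (c * z) ≡ z
  ⁻¹-cancelˡ {c} (_ , 0≢c) z = trans (sym (*-assoc _ _ _)) (trans (cong (_* z)
    (trans (*-comm _ _) (*-inverse c (λ e → 0≢c (sym e))))) (*-identityˡ z))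

  -- The inverse i of c equals c i², a product of nonnegative factors.
  0≤⁻¹ : ∀ {c} → 0# < c → 0# ≤ c ⁻¹
  0≤⁻¹ {c} 0<c = subst (0# ≤_)
    (trans (solve 2 (λ c i → c :* (i :* i) := i :* (c :* i)) refl c (c ⁻¹)) (⁻¹-cancelˡ 0<c (c ⁻¹)))
    (*-nonNeg (proj₁ 0<c) (0≤x² (c ⁻¹)))

  0<⁻¹ : ∀ {c} → 0# < c → 0# < c ⁻¹
  0<⁻¹ {c} 0<c = 0≤⁻¹ 0<c , λ 0≡i → 0≢1 (trans (sym (zeroʳ c))
    (trans (cong (c *_) 0≡i) (*-inverse c (λ e → proj₂ 0<c (sym e)))))

  *-cancelˡ-≤ : ∀ {x y c} → 0# < c → c * x ≤ c * y → x ≤ y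
  *-cancelˡ-≤ {x} {y} {c} 0<c p =
    subst₂ _≤_ (⁻¹-cancelˡ 0<c x) (⁻¹-cancelˡ 0<c y) (*-monoˡ-≤ (c ⁻¹) (0≤⁻¹ 0<c) p)

  0<fromℕ : ∀ n → 0# < fromℕ (suc n)
  0<fromℕ n = <-≤-trans 0<1 (x≤x+y (0≤fromℕ n))

  x≤∣x∣ : ∀ x → x ≤ ∣ x ∣
  x≤∣x∣ x with total 0# x
  ... | inj₁ _ = ≤-refl
  ... | inj₂ p = ≤-trans p (slack (≤⇒0≤ p) (solve 1 (λ x → (:- x) :- :0 := :0 :- x) refl x))

  -x≤∣x∣ : ∀ x → - x ≤ ∣ x ∣
  -x≤∣x∣ x with total 0# x
  ... | inj₁ p = ≤-trans (slack (≤⇒0≤ p) (solve 1 (λ x → :0 :- (:- x) := x :- :0) refl x)) p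
  ... | inj₂ _ = ≤-refl

  ∣∣≤ : ∀ {x b} → x ≤ b → - x ≤ b → ∣ x ∣ ≤ b
  ∣∣≤ {x} p q with total 0# x
  ... | inj₁ _ = p
  ... | inj₂ _ = q

  ∣∣≤-half : ∀ {x b} → ∣ x ∣ ≤ b → x ≤ b × - x ≤ b
  ∣∣≤-half {x} p = ≤-trans (x≤∣x∣ x) p , ≤-trans (-x≤∣x∣ x) p

  sup-isLub : ∀ {S} → ∃ S → ∃ (IsUpperBound S) → IsLub S (sup S)
  sup-isLub {S} inh ub with em {∃ (IsLub S)}
  ... | yes (_ , l) = l
  ... | no ¬l = ⊥-elim (¬l (complete S inh ub))

  -- Also correct for the junk value of sup, because b is nonnegative.
  sup≤ : ∀ {S b} → 0# ≤ b → IsUpperBound S b → sup S ≤ b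
  sup≤ {S} {b} 0≤b ub with em {∃ (IsLub S)}
  ... | yes (_ , _ , least) = least b ub
  ... | no _ = 0≤b

  -- If ℕ were bounded, with least upper bound s, then s - 1 would be an upper bound too, because ℕ
  -- is closed under successor.
  archimedean : ∀ x → ∃ λ n → x ≤ fromℕ n
  archimedean x with em {∃ λ n → x ≤ fromℕ n}
  ... | yes a = a
  ... | no ¬a with complete (λ y → ∃ λ n → y ≡ fromℕ n) (0# , 0 , refl)
                   (x , λ { _ (n , refl) → ≮⇒≥ (λ p → ¬a (n , p)) })
  ...   | s , ub , least = ⊥-elim (<⇒≱ 0<1 (slack (≤⇒0≤ (least (s - 1#) (λ { _ (n , refl) →
                 slack (≤⇒0≤ (ub (fromℕ (suc n)) (suc n , refl)))
                   (solve 2 (λ s n → (s :- :1) :- n := s :- (:1 :+ n)) refl s (fromℕ n)) })))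
               (solve 1 (λ s → :0 :- :1 := (s :- :1) :- s) refl s)))

  ^-homo-+ : ∀ x a b → x ^ (a ℕ.+ b) ≡ x ^ a * x ^ b
  ^-homo-+ x zero    b = sym (*-identityˡ _)
  ^-homo-+ x (suc a) b = trans (cong (x *_) (^-homo-+ x a b)) (sym (*-assoc _ _ _))

  ^-* : ∀ x a b → x ^ (a ℕ.* b) ≡ (x ^ b) ^ a
  ^-* x zero    b = refl
  ^-* x (suc a) b = trans (^-homo-+ x b (a ℕ.* b)) (cong (x ^ b *_) (^-* x a b))

  0≤^ : ∀ {x} n → 0# ≤ x → 0# ≤ x ^ n
  0≤^ zero    p = 0≤1
  0≤^ (suc n) p = *-nonNeg p (0≤^ n p)

  1^ : ∀ n → 1# ^ n ≡ 1#
  1^ zero    = refl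
  1^ (suc n) = trans (*-identityˡ _) (1^ n)

  ^-mono-≤ : ∀ {x y} n → 0# ≤ x → x ≤ y → x ^ n ≤ y ^ n
  ^-mono-≤ zero    0≤x p = ≤-refl
  ^-mono-≤ (suc n) 0≤x p = *-mono-≤ 0≤x (0≤^ n 0≤x) p (^-mono-≤ n 0≤x p)

  0<* : ∀ {x y} → 0# < x → 0# < y → 0# < x * y
  0<* {x} {y} p@(0≤x , _) (0≤y , 0≢y) = *-nonNeg 0≤x 0≤y , λ e → 0≢y
    (trans (sym (zeroʳ _)) (trans (cong (x ⁻¹ *_) e) (⁻¹-cancelˡ p y)))

  *-monoˡ-< : ∀ {x y c} → 0# < c → x < y → c * x < c * y
  *-monoˡ-< 0<c (p , n) = *-monoˡ-≤ _ (proj₁ 0<c) p , λ e → n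
    (trans (sym (⁻¹-cancelˡ 0<c _)) (trans (cong (_ *_) e) (⁻¹-cancelˡ 0<c _)))

  0<^ : ∀ {x} n → 0# < x → 0# < x ^ n
  0<^ zero    p = 0<1
  0<^ (suc n) p = 0<* p (0<^ n p)

  ^-mono-< : ∀ {x y} n → 0# < x → x < y → x ^ suc n < y ^ suc n
  ^-mono-< {x} {y} n 0<x x<y = <-≤-trans
    (subst₂ _<_ (*-comm _ _) (*-comm _ _) (*-monoˡ-< (0<^ n 0<x) x<y))
    (*-monoˡ-≤ y (≤-trans (proj₁ 0<x) (proj₁ x<y)) (^-mono-≤ n (proj₁ 0<x) (proj₁ x<y)))

  fromℕ-^ : ∀ a n → fromℕ (a ℕ.^ n) ≡ fromℕ a ^ n
  fromℕ-^ a zero    = +-identityʳ 1#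
  fromℕ-^ a (suc n) = trans (fromℕ-* a (a ℕ.^ n)) (cong (fromℕ a *_) (fromℕ-^ a n))

  fromℕ-cancel-≤ : ∀ {a b} → fromℕ a ≤ fromℕ b → a ℕ.≤ b
  fromℕ-cancel-≤ {a} {b} p with a ℕ.≤? b
  ... | yes q = q
  ... | no ¬q = ⊥-elim (<⇒≱ 0<1 (slack (≤⇒0≤ (≤-trans (fromℕ-mono (ℕₚ.≰⇒> ¬q)) p))
    (solve 1 (λ b → :0 :- :1 := b :- (:1 :+ b)) refl (fromℕ b))))

  module _ {x : ℝ} (0≤x : 0# ≤ x) where
    private
      below : ∃ λ y → y * y ≤ x
      below = 0# , subst (_≤ x) (sym (zeroˡ 0#)) 0≤x

      above : ∀ {b} → 0# ≤ b → x ≤ b * b → IsUpperBound (λ y → y * y ≤ x) b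
      above {b} 0≤b x≤b² y y²≤x with em {y ≤ b}
      ... | yes p = p
      ... | no ¬p = ⊥-elim (<⇒≱ b²<y² (≤-trans y²≤x x≤b²))
        where
        b<y = ≱⇒< ¬p
        b²<y² : b * b < y * y
        b²<y² = ≤-<-trans (*-monoˡ-≤ b 0≤b (proj₁ b<y))
          (subst (_< y * y) (*-comm y b) (*-monoˡ-< (≤-<-trans 0≤b b<y) b<y))

      isLub : IsLub (λ y → y * y ≤ x) (√ x)
      isLub = sup-isLub below (1# + x , above (0≤+ 0≤1 0≤x)
        (slack (0≤+ 0≤1 (0≤+ 0≤x (0≤x² x)))
          (solve 1 (λ x → (:1 :+ x) :* (:1 :+ x) :- x := :1 :+ (x :+ x :* x)) refl x)))

    √-upper : ∀ {y} → y * y ≤ x → y ≤ √ x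
    √-upper = proj₁ isLub _

    0≤√ : 0# ≤ √ x
    0≤√ = √-upper (proj₂ below)

    √-least : ∀ {b} → 0# ≤ b → x ≤ b * b → √ x ≤ b
    √-least 0≤b p = proj₂ isLub _ (above 0≤b p)

-- Square roots, powers of two, and polynomial arithmetic on coefficient lists.

module Polynomials (em : ExcludedMiddle 0ℓ) (R : CompleteOrderedField) where
  open Regression em R
  open Reals em R

  module _ {x : ℝ} (0≤x : 0# ≤ x) where
    private
      s = √ x
      0≤s = 0≤√ 0≤x

      -- Newton's step s - e, where 2 s e = s² - x, overestimates the root.
      s²≯x : ¬ (x < s * s)
      s²≯x (x≤s² , x≢s²) = <⇒≱ 0<e (slack (≤⇒0≤ s≤b) (solve 2 (λ s e → :0 :- e := (s :- e) :- s) refl s e))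
        where
        0<s : 0# < s
        0<s = 0≤s , λ 0≡s → x≢s² (≤-antisym x≤s² (subst (_≤ x) (sym (trans (cong (s *_) (sym 0≡s)) (zeroʳ s))) 0≤x))
        0<2s = 0<* 0<2 0<s
        e = ((1# + 1#) * s) ⁻¹ * (s * s - x)
        2se : (1# + 1#) * s * e ≡ s * s - x
        2se = trans (solve 3 (λ a i d → a :* (i :* d) := i :* (a :* d)) refl _ _ _) (⁻¹-cancelˡ 0<2s _)
        0<e : 0# < e
        0<e = 0<* (0<⁻¹ 0<2s) (≤⇒0≤ x≤s² , λ eq → x≢s² (sym (trans
          (solve 2 (λ s x → s := (s :- x) :+ x) refl (s * s) x) (trans (cong (_+ x) (sym eq)) (+-identityˡ x)))))
        s≤b : s ≤ s - e
        s≤b = √-least 0≤x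
          (*-cancelˡ-≤ 0<2s (slack (0≤+ (0≤x² s) 0≤x) (trans
            (solve 2 (λ s e → (:1 :+ :1) :* s :* (s :- e) :- (:1 :+ :1) :* s :* :0
                              := (:1 :+ :1) :* s :* s :- (:1 :+ :1) :* s :* e) refl s e)
            (trans (cong (λ z → (1# + 1#) * s * s - z) 2se)
              (solve 2 (λ s x → (:1 :+ :1) :* s :* s :- (s :* s :- x) := s :* s :+ x) refl s x)))))
          (slack (0≤x² e) (trans
            (solve 3 (λ s e x → (s :- e) :* (s :- e) :- x
              := (s :* s :- x) :- (:1 :+ :1) :* s :* e :+ e :* e) refl s e x)
            (trans (cong (λ z → (s * s - x) - z + e * e) 2se)
              (solve 2 (λ d e → d :- d :+ e :* e := e :* e) refl (s * s - x) e))))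

      -- With δ = x - s², the step t = δ / (1 + 2s + δ) is at most 1, so 2st + t² stays below δ and
      -- s + t is still in the set whose supremum is s.
      s²≮x : ¬ (s * s < x)
      s²≮x (s²≤x , s²≢x) = <⇒≱ 0<t (slack (≤⇒0≤ (√-upper 0≤x y²≤x))
          (solve 2 (λ s t → :0 :- t := s :- (s :+ t)) refl s t))
        where
        δ = x - s * s
        0≤δ = ≤⇒0≤ s²≤x
        0<δ : 0# < δ
        0<δ = 0≤δ , λ eq → s²≢x (sym (trans
          (solve 2 (λ s x → x := (x :- s) :+ s) refl (s * s) x) (trans (cong (_+ s * s) (sym eq)) (+-identityˡ _))))
        D = 1# + (s + s + δ)
        0<D : 0# < D
        0<D = <-≤-trans 0<1 (x≤x+y (0≤+ (0≤+ 0≤s 0≤s) 0≤δ))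
        t = D ⁻¹ * δ
        0<t = 0<* (0<⁻¹ 0<D) 0<δ
        Dt : D * t ≡ δ
        Dt = trans (solve 3 (λ a i d → a :* (i :* d) := i :* (a :* d)) refl _ _ _) (⁻¹-cancelˡ 0<D _)
        t≤1 : t ≤ 1#
        t≤1 = *-cancelˡ-≤ 0<D (subst (_≤ D * 1#) (sym Dt) (slack (0≤+ 0≤1 (0≤+ 0≤s 0≤s))
          (solve 2 (λ s δ → (:1 :+ (s :+ s :+ δ)) :* :1 :- δ := :1 :+ (s :+ s)) refl s δ)))
        y²≤x : (s + t) * (s + t) ≤ x
        y²≤x = slack (0≤+ (*-nonNeg (proj₁ 0<t) (≤⇒0≤ t≤1)) (*-nonNeg (proj₁ 0<t) 0≤δ)) (trans
          (solve 3 (λ s t x → x :- (s :+ t) :* (s :+ t)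
            := (x :- s :* s) :- ((:1 :+ :1) :* s :* t :+ t :* t)) refl s t x)
          (trans (cong (_- ((1# + 1#) * s * t + t * t)) (sym Dt))
            (solve 3 (λ s t δ → (:1 :+ (s :+ s :+ δ)) :* t :- ((:1 :+ :1) :* s :* t :+ t :* t)
                := t :* (:1 :- t) :+ t :* δ) refl s t δ)))

    √-square : √ x * √ x ≡ x
    √-square with em {√ x * √ x ≤ x} | em {x ≤ √ x * √ x}
    ... | yes p | yes q = ≤-antisym p q
    ... | no p  | _     = ⊥-elim (s²≯x (≱⇒< p))
    ... | yes _ | no q  = ⊥-elim (s²≮x (≱⇒< q))

  -- A rational power y = 2^((a-b)/n) of the defining set has a ≤ nm + b. If y exceeded 2^m, then
  -- 2^a = y^n 2^b would exceed 2^(nm+b), which is at least 2^a.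
  2^≤ : ∀ {x} m → x ≤ fromℕ m → 2^ x ≤ fromℕ 2 ^ m
  2^≤ {x} m x≤m = sup≤ (0≤^ m 0≤two) bound
    where
    two = fromℕ 2
    0≤two = 0≤fromℕ 2
    bound : IsUpperBound _ (two ^ m)
    bound y (a , b , suc n , _ , a-b≤nx , 0<y , e) with em {y ≤ two ^ m}
    ... | yes p = p
    ... | no ¬p = ⊥-elim (<⇒≱ strict (subst₂ _≤_ (sym e) rearrange
      (two-mono a (suc n ℕ.* m ℕ.+ b) (fromℕ-cancel-≤ a≤))))
      where
      a≤ : fromℕ a ≤ fromℕ (suc n ℕ.* m ℕ.+ b)
      a≤ = slack (0≤+ (≤⇒0≤ a-b≤nx) (*-nonNeg (0≤fromℕ (suc n)) (≤⇒0≤ x≤m))) (trans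
        (cong (_- fromℕ a) (trans (fromℕ-+ (suc n ℕ.* m) b) (cong (_+ fromℕ b) (fromℕ-* (suc n) m))))
        (solve 5 (λ n m a b x → n :* m :+ b :- a := (n :* x :- (a :- b)) :+ n :* (m :- x)) refl
          (fromℕ (suc n)) (fromℕ m) (fromℕ a) (fromℕ b) x))
      two-mono : ∀ i j → i ℕ.≤ j → two ^ i ≤ two ^ j
      two-mono i j p = subst₂ _≤_ (fromℕ-^ 2 i) (fromℕ-^ 2 j) (fromℕ-mono (ℕₚ.^-monoʳ-≤ 2 p))
      rearrange : two ^ (suc n ℕ.* m ℕ.+ b) ≡ (two ^ m) ^ suc n * two ^ b
      rearrange = trans (^-homo-+ two (suc n ℕ.* m) b) (cong (_* two ^ b) (^-* two (suc n) m))
      strict : (two ^ m) ^ suc n * two ^ b < y ^ suc n * two ^ b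
      strict = subst₂ _<_ (*-comm _ _) (*-comm _ _) (*-monoˡ-< (0<^ b (0<fromℕ 1))
        (^-mono-< n (0<^ m (0<fromℕ 1)) (≱⇒< ¬p)))

  infixl 6 _⊕_
  infixl 7 _⊛_

  _⊕_ : Poly → Poly → Poly
  []      ⊕ q       = q
  (a ∷ p) ⊕ []      = a ∷ p
  (a ∷ p) ⊕ (b ∷ q) = a + b ∷ (p ⊕ q)

  scale : ℝ → Poly → Poly
  scale a = List.map (a *_)

  _⊛_ : Poly → Poly → Poly
  []      ⊛ q = []
  (a ∷ p) ⊛ q = scale a q ⊕ (0# ∷ (p ⊛ q))

  power : Poly → ℕ → Poly
  power p zero    = 1# ∷ []
  power p (suc k) = power p k ⊛ p

  compose : Poly → Poly → Poly
  compose []      q = []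
  compose (a ∷ p) q = (a ∷ []) ⊕ compose p q ⊛ q

  eval-⊕ : ∀ p q x → eval (p ⊕ q) x ≡ eval p x + eval q x
  eval-⊕ []      q       x = sym (+-identityˡ _)
  eval-⊕ (a ∷ p) []      x = sym (+-identityʳ _)
  eval-⊕ (a ∷ p) (b ∷ q) x = trans (cong (λ z → a + b + x * z) (eval-⊕ p q x))
    (solve 5 (λ a b x u v → a :+ b :+ x :* (u :+ v) := (a :+ x :* u) :+ (b :+ x :* v)) refl a b x _ _)

  eval-scale : ∀ a p x → eval (scale a p) x ≡ a * eval p x
  eval-scale a []      x = sym (zeroʳ a)
  eval-scale a (b ∷ p) x = trans (cong (λ z → a * b + x * z) (eval-scale a p x))
    (solve 4 (λ a b x u → a :* b :+ x :* (a :* u) := a :* (b :+ x :* u)) refl a b x _)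

  eval-⊛ : ∀ p q x → eval (p ⊛ q) x ≡ eval p x * eval q x
  eval-⊛ []      q x = sym (zeroˡ _)
  eval-⊛ (a ∷ p) q x = trans (eval-⊕ (scale a q) _ x)
    (trans (cong₂ (λ u v → u + (0# + x * v)) (eval-scale a q x) (eval-⊛ p q x))
      (solve 4 (λ a x u v → a :* v :+ (:0 :+ x :* (u :* v)) := (a :+ x :* u) :* v) refl a x _ _))

  eval-power : ∀ p k x → eval (power p k) x ≡ eval p x ^ k
  eval-power p zero    x = solve 1 (λ x → :1 :+ x :* :0 := :1) refl x
  eval-power p (suc k) x = trans (eval-⊛ (power p k) p x)
    (trans (cong (_* eval p x) (eval-power p k x)) (*-comm _ _))

  eval-compose : ∀ p q x → eval (compose p q) x ≡ eval p (eval q x)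
  eval-compose []      q x = refl
  eval-compose (a ∷ p) q x = trans (eval-⊕ (a ∷ []) (compose p q ⊛ q) x)
    (trans (cong (a + x * 0# +_) (trans (eval-⊛ (compose p q) q x) (cong (_* eval q x) (eval-compose p q x))))
      (solve 4 (λ a x u v → a :+ x :* :0 :+ u :* v := a :+ v :* u) refl a x _ _))

  -- Degrees are tracked as list lengths (degree plus one), which follow the recursion of the
  -- operations and tolerate vanishing leading coefficients.
  length-⊕ : ∀ p q {n} → length p ℕ.≤ n → length q ℕ.≤ n → length (p ⊕ q) ℕ.≤ n
  length-⊕ []      q       _       l       = l
  length-⊕ (a ∷ p) []      l       _       = l
  length-⊕ (a ∷ p) (b ∷ q) (s≤s k) (s≤s l) = s≤s (length-⊕ p q k l)

  length-scale : ∀ a p {n} → length p ℕ.≤ n → length (scale a p) ℕ.≤ n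
  length-scale a p l = subst (ℕ._≤ _) (sym (Listₚ.length-map (a *_) p)) l

  length-⊛ : ∀ p q {m n} → length p ℕ.≤ m → length q ℕ.≤ suc n → length (p ⊛ q) ℕ.≤ m ℕ.+ n
  length-⊛ []      q         _       _ = z≤n
  length-⊛ (a ∷ p) q {suc m} (s≤s k) l = length-⊕ (scale a q) (0# ∷ p ⊛ q)
    (length-scale a q (ℕₚ.≤-trans l (s≤s (ℕₚ.m≤n+m _ m)))) (s≤s (length-⊛ p q k l))

  length-power : ∀ p k {n} → length p ℕ.≤ suc n → length (power p k) ℕ.≤ suc (k ℕ.* n)
  length-power p zero    l = s≤s z≤n
  length-power p (suc k) {n} l = subst (length (power p (suc k)) ℕ.≤_) (cong suc (ℕₚ.+-comm (k ℕ.* n) n))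
    (length-⊛ (power p k) p (length-power p k l) l)

  length-compose : ∀ p q {m n} → length p ℕ.≤ suc m → length q ℕ.≤ suc n →
    length (compose p q) ℕ.≤ suc (m ℕ.* n)
  length-compose []       q l k = z≤n
  -- Constants are split off because their bound m may be 0; in the next clause m is a successor and
  -- the recursion can lower it.
  length-compose (a ∷ []) q l k = s≤s z≤n
  length-compose (a ∷ p@(_ ∷ _)) q {suc m} {n} (s≤s l) k = length-⊕ (a ∷ []) (compose p q ⊛ q) (s≤s z≤n)
    (subst (length (compose p q ⊛ q) ℕ.≤_) (cong suc (ℕₚ.+-comm (m ℕ.* n) n))
      (length-⊛ (compose p q) q (length-compose p q l k) k))

  length⇒Degree≤ : ∀ {d} p → length p ℕ.≤ suc d → Degree≤ d p
  length⇒Degree≤ {d} p l i d<i = beyond p i (ℕₚ.≤-trans l d<i)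
    where
    beyond : ∀ p i → length p ℕ.≤ i → coeff p i ≡ 0#
    beyond []      i       _       = refl
    beyond (a ∷ p) (suc i) (s≤s l) = beyond p i l

  ∑ : {A : Set} → List A → (A → ℝ) → ℝ
  ∑ []       f = 0#
  ∑ (a ∷ as) f = f a + ∑ as f

  0≤∑ : ∀ {A : Set} {f : A → ℝ} as → All (λ a → 0# ≤ f a) as → 0# ≤ ∑ as f
  0≤∑ []       []       = ≤-refl
  0≤∑ (a ∷ as) (p ∷ ps) = 0≤+ p (0≤∑ as ps)

-- Bumps: nonnegative polynomials with sum at most 1, each equal to 1 at its node.

module Families (em : ExcludedMiddle 0ℓ) (R : CompleteOrderedField) where
  open Regression em R
  open Reals em R
  open Polynomials em R

  record Bump : Set where
    constructor _,_
    field
      node    : ℝ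
      profile : Poly
  open Bump

  record IsBump (D : ℕ) (b : Bump) : Set where
    field
      degree : length (profile b) ℕ.≤ suc D
      inside : In[-1,1] (node b)
      peak   : eval (profile b) (node b) ≡ 1#
      nonneg : ∀ x → In[-1,1] x → 0# ≤ eval (profile b) x
  open IsBump

  record Bumps (D m : ℕ) : Set where
    field
      bumps   : List Bump
      number  : length bumps ≡ m
      isBump  : All (IsBump D) bumps
      sum≤1   : ∀ x → In[-1,1] x → ∑ bumps (λ b → eval (profile b) x) ≤ 1#

  0-inside : In[-1,1] 0#
  0-inside = slack 0≤1 (solve 0 (:0 :- (:- :1) := :1) refl) , 0≤1

  eval-[1] : ∀ x → eval (1# ∷ []) x ≡ 1#
  eval-[1] = solve 1 (λ x → :1 :+ x :* :0 := :1) refl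

  -- Serves degrees too small for the Chebyshev bumps: the resulting family consists of two
  -- constants, 0 and the height.
  constantBump : Bumps 0 1
  constantBump = record
    { bumps  = (0# , 1# ∷ []) ∷ []
    ; number = refl
    ; isBump = record
        { degree = s≤s z≤n
        ; inside = 0-inside
        ; peak   = eval-[1] 0#
        ; nonneg = λ x _ → ≤-trans 0≤1 (≤-reflexive (sym (eval-[1] x)))
        } ∷ []
    ; sum≤1  = λ x _ → ≤-reflexive (trans (+-identityʳ _) (eval-[1] x))
    }

  -- Chebyshev nodes and Fejér kernels by angle doubling.

  T₂ : Poly
  T₂ = - 1# ∷ 0# ∷ 1# + 1# ∷ []

  eval-T₂ : ∀ x → eval T₂ x ≡ (1# + 1#) * (x * x) - 1#
  eval-T₂ = solve 1 (λ x → :- :1 :+ x :* (:0 :+ x :* ((:1 :+ :1) :+ x :* :0))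
                          := (:1 :+ :1) :* (x :* x) :- :1) refl

  -- For w = cos θ with θ in [0,π] this is cos (θ/2); it and its negative are the two solutions v of
  -- T₂(v) = w.
  halfAngle : ℝ → ℝ
  halfAngle w = √ ((1# + 1#) ⁻¹ * (1# + w))

  -- The Chebyshev polynomial of degree 2n is T ∘ T₂, with T that of degree n. As T₂(x) - w = 2(x -
  -- v)(x + v), dividing it by 2n(x - v) leaves g(T₂(x)) (x + v).
  child : Poly → ℝ → ℝ × Poly
  child g v = v , compose g T₂ ⊛ (v ∷ 1# ∷ [])

  refine : List (ℝ × Poly) → List (ℝ × Poly)
  refine []            = []
  refine ((w , g) ∷ l) = child g (halfAngle w) ∷ child g (- halfAngle w) ∷ refine l

  -- For (w , g) in chebyshev r, the w are the roots of the Chebyshev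
  -- polynomial T of degree n = 2 ^ r and g(x) = T(x) / (n (x - w));
  -- bumpAt (w , g) is the Fejér kernel g(x)² (1 - x w).
  chebyshev : ℕ → List (ℝ × Poly)
  chebyshev zero    = (0# , 1# ∷ []) ∷ []
  chebyshev (suc r) = refine (chebyshev r)

  bumpAt : ℝ × Poly → Bump
  bumpAt (w , g) = w , g ⊛ g ⊛ (1# ∷ - w ∷ [])

  eval-bumpAt : ∀ w g x → eval (profile (bumpAt (w , g))) x ≡ eval g x * eval g x * (1# - x * w)
  eval-bumpAt w g x = trans (eval-⊛ (g ⊛ g) _ x) (cong₂ _*_ (eval-⊛ g g x)
    (solve 2 (λ x w → :1 :+ x :* ((:- w) :+ x :* :0) := :1 :- x :* w) refl x w))

  eval-child : ∀ g v x → eval (proj₂ (child g v)) x ≡ eval g ((1# + 1#) * (x * x) - 1#) * (x + v)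
  eval-child g v x = trans (eval-⊛ (compose g T₂) _ x) (cong₂ _*_
    (trans (eval-compose g T₂ x) (cong (eval g) (eval-T₂ x)))
    (solve 2 (λ x v → v :+ x :* (:1 :+ x :* :0) := x :+ v) refl x v))

  length-chebyshev : ∀ r → length (chebyshev r) ≡ 2 ℕ.^ r
  length-chebyshev zero    = refl
  length-chebyshev (suc r) = trans (length-refine (chebyshev r))
    (trans (cong (ℕ._* 2) (length-chebyshev r)) (ℕₚ.*-comm (2 ℕ.^ r) 2))
    where
    length-refine : ∀ l → length (refine l) ≡ length l ℕ.* 2
    length-refine []      = refl
    length-refine (_ ∷ l) = cong (λ n → suc (suc n)) (length-refine l)

  -- The field `peak` says g(w)² (1 - w²) = 1, the algebraic form of T'(w)² (1 - w²) = n² at a root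
  -- w of T.
  record Root (e : ℕ) (wg : ℝ × Poly) : Set where
    field
      degree : length (proj₂ wg) ℕ.≤ suc e
      inside : In[-1,1] (proj₁ wg)
      peak   : eval (profile (bumpAt wg)) (proj₁ wg) ≡ 1#

  module _ {w : ℝ} (w-in : In[-1,1] w) where
    private
      -1≤w = proj₁ w-in
      w≤1 = proj₂ w-in
      c = (1# + 1#) ⁻¹ * (1# + w)
      2c : (1# + 1#) * c ≡ 1# + w
      2c = trans (solve 3 (λ a i d → a :* (i :* d) := i :* (a :* d)) refl _ _ _) (⁻¹-cancelˡ 0<2 _)
      0≤c : 0# ≤ c
      0≤c = *-nonNeg (0≤⁻¹ 0<2) (slack (≤⇒0≤ -1≤w) (solve 1 (λ w → (:1 :+ w) :- :0 := w :- (:- :1)) refl w))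
      0≤v : 0# ≤ halfAngle w
      0≤v = 0≤√ 0≤c

    halfAngle-square : w ≡ (1# + 1#) * (halfAngle w * halfAngle w) - 1#
    halfAngle-square = trans (solve 1 (λ w → w := (:1 :+ w) :- :1) refl w)
      (cong (_- 1#) (trans (sym 2c) (cong ((1# + 1#) *_) (sym (√-square 0≤c)))))

    halfAngle-inside : In[-1,1] (halfAngle w) × In[-1,1] (- halfAngle w)
    halfAngle-inside = (≤-trans (slack 0≤1 (solve 0 (:0 :- (:- :1) := :1) refl)) 0≤v , v≤1)
      , (neg-mono-≤ v≤1 , ≤-trans (neg-mono-≤ 0≤v) (slack 0≤1 (solve 0 (:1 :- (:- :0) := :1) refl)))
      where
      v≤1 : halfAngle w ≤ 1#
      v≤1 = √-least 0≤c 0≤1 (*-cancelˡ-≤ 0<2 (subst (_≤ (1# + 1#) * (1# * 1#)) (sym 2c) (slack (≤⇒0≤ w≤1)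
        (solve 1 (λ w → (:1 :+ :1) :* (:1 :* :1) :- (:1 :+ w) := :1 :- w) refl w))))

  -- The peak is inherited through (2v)² (1 - v²) = 1 - (2v² - 1)², the double-angle formula for the
  -- sine, squared.
  child-root : ∀ {e w g v} → Root e (w , g) → In[-1,1] v → w ≡ (1# + 1#) * (v * v) - 1# →
               Root (e ℕ.* 2 ℕ.+ 1) (child g v)
  child-root {e} {w} {g} {v} r v-in refl = record
    { degree = length-⊛ (compose g T₂) _ (length-compose g T₂ (Root.degree r) ℕₚ.≤-refl) ℕₚ.≤-refl
    ; inside = v-in
    ; peak   = trans (eval-bumpAt v (proj₂ (child g v)) v)
        (trans (cong (λ z → z * z * (1# - v * v)) (eval-child g v v))
        (trans (solve 2 (λ G v → (G :* (v :+ v)) :* (G :* (v :+ v)) :* (:1 :- v :* v)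
             := G :* G :* (:1 :- ((:1 :+ :1) :* (v :* v) :- :1) :* ((:1 :+ :1) :* (v :* v) :- :1)))
           refl (eval g w) v)
        (trans (sym (eval-bumpAt w g w)) (Root.peak r))))
    }

  -- Equal to 2^r - 1, in the form that the recursion delivers: composition with `T₂` doubles the
  -- degree of g and the linear factor adds one.
  chebyshevDegree : ℕ → ℕ
  chebyshevDegree zero    = 0
  chebyshevDegree (suc r) = chebyshevDegree r ℕ.* 2 ℕ.+ 1

  chebyshev-roots : ∀ r → All (Root (chebyshevDegree r)) (chebyshev r)
  chebyshev-roots zero    = record
    { degree = s≤s z≤n
    ; inside = 0-inside
    ; peak   = trans (eval-bumpAt 0# (1# ∷ []) 0#)
        (solve 0 ((:1 :+ :0 :* :0) :* (:1 :+ :0 :* :0) :* (:1 :- :0 :* :0) := :1) refl)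
    } ∷ []
  chebyshev-roots (suc r) = refine-roots (chebyshev-roots r)
    where
    refine-roots : ∀ {e l} → All (Root e) l → All (Root (e ℕ.* 2 ℕ.+ 1)) (refine l)
    refine-roots []       = []
    refine-roots {l = (w , g) ∷ _} (p ∷ ps) =
      child-root p (proj₁ (halfAngle-inside (Root.inside p))) (halfAngle-square (Root.inside p)) ∷
      child-root p (proj₂ (halfAngle-inside (Root.inside p))) (trans (halfAngle-square (Root.inside p))
        (solve 1 (λ v → (:1 :+ :1) :* (v :* v) :- :1
          := (:1 :+ :1) :* ((:- v) :* (:- v)) :- :1) refl (halfAngle w))) ∷
      refine-roots ps

  -- The kernels of the two children of a node add up to the kernel of that node at T₂(x), so each
  -- level inherits the sum from the one before. These are polynomial identities, valid for all real
  -- x.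
  fejér : ∀ r x → ∑ (chebyshev r) (λ wg → eval (profile (bumpAt wg)) x) ≡ 1#
  fejér zero    x = trans (+-identityʳ _) (trans (eval-bumpAt 0# (1# ∷ []) x)
    (solve 1 (λ x → (:1 :+ x :* :0) :* (:1 :+ x :* :0) :* (:1 :- x :* :0) := :1) refl x))
  fejér (suc r) x = trans (∑-refine (chebyshev r) (chebyshev-roots r)) (fejér r t)
    where
    t = (1# + 1#) * (x * x) - 1#
    -- The identity (x+v)²(1-xv) + (x-v)²(1+xv) = 1 - (2x²-1)(2v²-1).
    merge : ∀ w g v → w ≡ (1# + 1#) * (v * v) - 1# →
      eval (profile (bumpAt (child g v))) x + eval (profile (bumpAt (child g (- v)))) x ≡
      eval (profile (bumpAt (w , g))) t
    merge w g v refl = trans (cong₂ _+_ (side v) (side (- v)))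
      (trans (solve 3 (λ G x v → G :* (x :+ v) :* (G :* (x :+ v)) :* (:1 :- x :* v) :+
                         G :* (x :+ :- v) :* (G :* (x :+ :- v)) :* (:1 :- x :* (:- v))
                         := G :* G :* (:1 :- ((:1 :+ :1) :* (x :* x) :- :1) :* ((:1 :+ :1) :* (v :* v) :- :1)))
          refl (eval g t) x v)
        (sym (eval-bumpAt w g t)))
      where
      side : ∀ u → eval (profile (bumpAt (child g u))) x ≡
             eval g t * (x + u) * (eval g t * (x + u)) * (1# - x * u)
      side u = trans (eval-bumpAt u (proj₂ (child g u)) x)
        (cong (λ z → z * z * (1# - x * u)) (eval-child g u x))
    ∑-refine : ∀ {e} l → All (Root e) l → ∑ (refine l) (λ wg → eval (profile (bumpAt wg)) x) ≡
                               ∑ l (λ wg → eval (profile (bumpAt wg)) t)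
    ∑-refine []            []       = refl
    ∑-refine ((w , g) ∷ l) (p ∷ ps) = trans (sym (+-assoc _ _ _))
      (cong₂ _+_ (merge w g (halfAngle w) (halfAngle-square (Root.inside p))) (∑-refine l ps))

  ∑-map : ∀ {A B : Set} (h : A → B) (f : B → ℝ) as → ∑ (List.map h as) f ≡ ∑ as (λ a → f (h a))
  ∑-map h f []       = refl
  ∑-map h f (a ∷ as) = cong (f (h a) +_) (∑-map h f as)

  suc-chebyshevDegree : ∀ r → suc (chebyshevDegree r) ≡ 2 ℕ.^ r
  suc-chebyshevDegree zero    = refl
  suc-chebyshevDegree (suc r) = trans (cong suc (ℕₚ.+-comm (chebyshevDegree r ℕ.* 2) 1))
    (trans (cong (ℕ._* 2) (suc-chebyshevDegree r)) (ℕₚ.*-comm (2 ℕ.^ r) 2))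

  1-xw-nonneg : ∀ {x w} → In[-1,1] x → In[-1,1] w → 0# ≤ 1# - x * w
  1-xw-nonneg {x} {w} (-1≤x , x≤1) (-1≤w , w≤1) = *-cancelˡ-≤ 0<2 (slack
    (0≤+ (*-nonNeg (≤⇒0≤ -1≤x) (≤⇒0≤ w≤1)) (*-nonNeg (≤⇒0≤ x≤1) (≤⇒0≤ -1≤w)))
    (solve 2 (λ x w → (:1 :+ :1) :* (:1 :- x :* w) :- (:1 :+ :1) :* :0 :=
       (x :- (:- :1)) :* (:1 :- w) :+ (:1 :- x) :* (w :- (:- :1))) refl x w))

  chebyshevBumps : ∀ r → Bumps (2 ℕ.^ suc r) (2 ℕ.^ r)
  chebyshevBumps r = record
    { bumps  = List.map bumpAt (chebyshev r)
    ; number = trans (Listₚ.length-map bumpAt (chebyshev r)) (length-chebyshev r)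
    ; isBump = Allₚ.map⁺ (All.map bump (chebyshev-roots r))
    ; sum≤1  = λ x _ → ≤-reflexive (trans (∑-map bumpAt _ (chebyshev r)) (fejér r x))
    }
    where
    e = chebyshevDegree r
    -- The kernel is g² times a linear factor, of degree 2e + 1 = 2^(r+1) - 1; the bound is rounded
    -- up by one.
    bound : suc e ℕ.+ e ℕ.+ 1 ℕ.≤ suc (2 ℕ.^ suc r)
    bound = begin
      suc e ℕ.+ e ℕ.+ 1     ≡⟨ ℕₚ.+-assoc (suc e) e 1 ⟩
      suc e ℕ.+ (e ℕ.+ 1)   ≡⟨ cong (suc e ℕ.+_) (ℕₚ.+-comm e 1) ⟩
      suc e ℕ.+ suc e       ≡⟨ cong₂ ℕ._+_ (suc-chebyshevDegree r)
                               (trans (suc-chebyshevDegree r) (sym (ℕₚ.+-identityʳ _))) ⟩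
      2 ℕ.^ suc r           ≤⟨ ℕₚ.n≤1+n _ ⟩
      suc (2 ℕ.^ suc r)     ∎
      where open ℕₚ.≤-Reasoning
    bump : ∀ {wg} → Root e wg → IsBump (2 ℕ.^ suc r) (bumpAt wg)
    bump {w , g} p = record
      { degree = ℕₚ.≤-trans (length-⊛ (g ⊛ g) _ (length-⊛ g g (Root.degree p) (Root.degree p)) ℕₚ.≤-refl) bound
      ; inside = Root.inside p
      ; peak   = Root.peak p
      ; nonneg = λ x x-in → subst (0# ≤_) (sym (eval-bumpAt w g x))
          (*-nonNeg (0≤x² (eval g x)) (1-xw-nonneg x-in (Root.inside p)))
      }

  -- Subset sums of spikes.

  module Spikes {D m : ℕ} (B : Bumps D m) (k : ℕ) where
    height : ℝ
    height = (1# + 1#) ^ k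

    0≤height : 0# ≤ height
    0≤height = 0≤^ k (proj₁ 0<2)

    spike : Bump → Poly
    spike b = scale height (power (profile b) (suc k))

    family : List Bump → List Poly
    family []       = [] ∷ []
    family (b ∷ bs) = List.map (spike b ⊕_) (family bs) ++ family bs

    eval-spike : ∀ b x → eval (spike b) x ≡ height * eval (profile b) x ^ suc k
    eval-spike b x = trans (eval-scale height (power (profile b) (suc k)) x)
      (cong (height *_) (eval-power (profile b) (suc k) x))

    eval-peak : ∀ {b} → IsBump D b → eval (spike b) (node b) ≡ height
    eval-peak {b} p = trans (eval-spike b (node b))
      (trans (cong (λ z → height * z ^ suc k) (peak p)) (trans (cong (height *_) (1^ (suc k))) (*-identityʳ _)))

    -- The spike is h (2h)^k, and 2h is at most 1 here. The extra factor h is the reason for the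
    -- exponent k + 1: the suppressed spikes together add at most the sum of the h, however many
    -- there are.
    spike-small : ∀ b x → 0# ≤ eval (profile b) x → eval (profile b) x + eval (profile b) x ≤ 1# →
                  eval (spike b) x ≤ eval (profile b) x
    spike-small b x 0≤h 2h≤1 = subst₂ _≤_ (sym (trans (eval-spike b x) (regroup h k))) (*-identityʳ h)
      (*-monoˡ-≤ h 0≤h (subst ((h + h) ^ k ≤_) (1^ k) (^-mono-≤ k (0≤+ 0≤h 0≤h) 2h≤1)))
      where
      h = eval (profile b) x
      regroup : ∀ h k → (1# + 1#) ^ k * (h * h ^ k) ≡ h * (h + h) ^ k
      regroup h zero    = solve 1 (λ h → :1 :* (h :* :1) := h :* :1) refl h
      regroup h (suc k) = trans
        (solve 3 (λ a h b → (:1 :+ :1) :* a :* (h :* (h :* b)) := (h :+ h) :* (a :* (h :* b))) refl _ h _)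
        (trans (cong ((h + h) *_) (regroup h k))
          (solve 3 (λ u h v → u :* (h :* v) := h :* (u :* v)) refl _ h _))

    spike-nonneg : ∀ b x → 0# ≤ eval (profile b) x → 0# ≤ eval (spike b) x
    spike-nonneg b x 0≤h = subst (0# ≤_) (sym (eval-spike b x)) (*-nonNeg 0≤height (0≤^ (suc k) 0≤h))

    length-family : ∀ bs → length (family bs) ≡ 2 ℕ.^ length bs
    length-family []       = refl
    length-family (b ∷ bs) = trans (Listₚ.length-++ (List.map (spike b ⊕_) (family bs)))
      (trans (cong (ℕ._+ length (family bs)) (Listₚ.length-map _ (family bs)))
        (trans (cong (λ n → n ℕ.+ n) (length-family bs)) (cong (2 ℕ.^ length bs ℕ.+_) (sym (ℕₚ.+-identityʳ _)))))

    family-length : ∀ {bs} → All (IsBump D) bs → All (λ p → length p ℕ.≤ suc (suc k ℕ.* D)) (family bs)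
    family-length []       = z≤n ∷ []
    family-length {b ∷ _} (p ∷ ps) = Allₚ.++⁺ (Allₚ.map⁺ (All.map (λ {q} l → length-⊕ (spike b) q
      (length-scale height (power (profile b) (suc k)) (length-power (profile b) (suc k) (degree p))) l)
      (family-length ps))) (family-length ps)

    module At (x : ℝ) where
      h : Bump → ℝ
      h b = eval (profile b) x

      Small : Bump → Set
      Small b = h b + h b ≤ 1#

      family-small : ∀ {bs} → All (λ b → 0# ≤ h b) bs → All Small bs →
                     All (λ p → 0# ≤ eval p x × eval p x ≤ ∑ bs h) (family bs)
      family-small []         []       = (≤-refl , ≤-refl) ∷ []
      family-small {b ∷ bs} (0≤h ∷ ps) (s ∷ ss) = Allₚ.++⁺
        (Allₚ.map⁺ (All.map (λ {q} (0≤q , q≤) → subst (λ z → 0# ≤ z × z ≤ h b + ∑ bs h)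
           (sym (eval-⊕ (spike b) q x))
           (0≤+ (spike-nonneg b x 0≤h) 0≤q , +-mono-≤ (spike-small b x 0≤h s) q≤)) rest))
        (All.map (λ (0≤q , q≤) → 0≤q , subst (_≤ h b + ∑ bs h) (+-identityˡ _) (+-mono-≤ 0≤h q≤)) rest)
        where rest = family-small ps ss

      ∑≤half⇒Small : ∀ {bs} → All (λ b → 0# ≤ h b) bs → ∑ bs h + ∑ bs h ≤ 1# → All Small bs
      ∑≤half⇒Small [] _ = []
      ∑≤half⇒Small {b ∷ bs} (0≤h ∷ ps) l =
        ≤-trans (+-mono-≤ h≤ h≤) l ∷ ∑≤half⇒Small ps (≤-trans (+-mono-≤ t≤ t≤) l)
        where
        h≤ : h b ≤ h b + ∑ bs h
        h≤ = x≤x+y (0≤∑ bs ps)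
        t≤ : ∑ bs h ≤ h b + ∑ bs h
        t≤ = x≤y+x 0≤h

      -- One u has to serve all members at x: it is the value of the only tall spike there, or 0 if
      -- there is none. The width s covers the contribution of the small spikes.
      TwoValued : ℝ → ℝ → Poly → Set
      TwoValued u s p = (0# ≤ eval p x × eval p x ≤ s) ⊎ (u ≤ eval p x × eval p x ≤ u + s)

      -- At most one bump exceeds 1/2 at x, and that one accounts for the second value.
      family-twoValued : ∀ {bs} → All (λ b → 0# ≤ h b) bs → ∑ bs h ≤ 1# →
                         ∃ λ u → All (TwoValued u (∑ bs h)) (family bs)
      family-twoValued [] _ = 0# , inj₁ (≤-refl , ≤-refl) ∷ []
      family-twoValued {b ∷ bs} (0≤h ∷ ps) l with total (h b + h b) 1#
      ... | inj₁ 2h≤1 with family-twoValued ps (≤-trans (x≤y+x 0≤h) l)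
      ...   | u , rest = u , Allₚ.++⁺ (Allₚ.map⁺ (All.map (λ {q} → add q) rest)) (All.map (λ {q} → keep q) rest)
        where
        s = ∑ bs h
        shift : ∀ {a z} → 0# ≤ a → a ≤ h b →
          ((0# ≤ z × z ≤ s) ⊎ (u ≤ z × z ≤ u + s)) →
          (0# ≤ a + z × a + z ≤ h b + s) ⊎ (u ≤ a + z × a + z ≤ u + (h b + s))
        shift 0≤a a≤ (inj₁ (p , q)) = inj₁ (0≤+ 0≤a p , +-mono-≤ a≤ q)
        shift {a} {z} 0≤a a≤ (inj₂ (p , q)) = inj₂ (≤-trans p (x≤y+x 0≤a) , slack (0≤+ (≤⇒0≤ a≤) (≤⇒0≤ q))
          (solve 5 (λ v h s a z → v :+ (h :+ s) :- (a :+ z) := (h :- a) :+ (v :+ s :- z)) refl u (h b) s a z))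
        add : ∀ q → TwoValued u s q → TwoValued u (h b + s) (spike b ⊕ q)
        add q t = subst (λ z → (0# ≤ z × z ≤ h b + s) ⊎ (u ≤ z × z ≤ u + (h b + s)))
          (sym (eval-⊕ (spike b) q x))
          (shift (spike-nonneg b x 0≤h) (spike-small b x 0≤h 2h≤1) t)
        keep : ∀ q → TwoValued u s q → TwoValued u (h b + s) q
        keep q t = subst (λ z → (0# ≤ z × z ≤ h b + s) ⊎ (u ≤ z × z ≤ u + (h b + s))) (+-identityˡ _)
          (shift ≤-refl 0≤h t)
      family-twoValued {b ∷ bs} (0≤h ∷ ps) l | inj₂ 1≤2h = u , Allₚ.++⁺
        (Allₚ.map⁺ (All.map (λ {q} (0≤q , q≤) → inj₂ (subst (λ z → u ≤ z × z ≤ u + (h b + s))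
          (sym (eval-⊕ (spike b) q x))
          ( x≤x+y 0≤q
          , +-mono-≤ ≤-refl (≤-trans q≤ s≤))))
          rest))
        (All.map (λ (0≤q , q≤) → inj₁ (0≤q , ≤-trans q≤ s≤)) rest)
        where
        s = ∑ bs h
        u = eval (spike b) x
        s≤ : s ≤ h b + s
        s≤ = x≤y+x 0≤h
        rest = family-small ps (∑≤half⇒Small ps (slack (0≤+ (≤⇒0≤ 1≤2h) (0≤+ (≤⇒0≤ l) (≤⇒0≤ l)))
          (solve 2 (λ h s → :1 :- (s :+ s)
            := ((h :+ h) :- :1) :+ ((:1 :- (h :+ s)) :+ (:1 :- (h :+ s)))) refl (h b) s)))

    Apart : Poly → Poly → Set
    Apart p q = ∃ λ z → In[-1,1] z × eval p z - eval q z ≡ height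

    -- Two members are told apart at the node of a bump that only one of
    -- them contains: all other bumps vanish there.
    family-apart : ∀ {bs} → All (IsBump D) bs →
                   (∀ x → In[-1,1] x → ∑ bs (λ b → eval (profile b) x) ≤ 1#) → AllPairs Apart (family bs)
    family-apart [] _ = [] ∷ []
    family-apart {b ∷ bs} (p ∷ ps) l = AllPairsₚ.++⁺
      (AllPairsₚ.map⁺ (AllPairs.map (λ {q} {r} (z , z-in , e) → z , z-in ,
        trans (cong₂ _-_ (eval-⊕ (spike b) q z) (eval-⊕ (spike b) r z))
          (trans (solve 3 (λ a q r → (a :+ q) :- (a :+ r) := q :- r) refl
            (eval (spike b) z) (eval q z) (eval r z)) e)) rest))
      rest
      (Allₚ.map⁺ (All.map (λ {q} q0 → All.map (λ {r} r0 → node b , inside p ,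
        trans (cong₂ _-_ (trans (eval-⊕ (spike b) q (node b)) (cong₂ _+_ (eval-peak p) q0)) r0)
          (solve 1 (λ M → (M :+ :0) :- :0 := M) refl height)) zeros) zeros))
      where
      open At (node b)
      s = ∑ bs h
      -- The bump b alone contributes 1 at its node and so uses up the whole bound on the sum.
      s≤0 : s ≤ 0#
      s≤0 = slack (≤⇒0≤ (subst (λ z → z + s ≤ 1#) (peak p) (l (node b) (inside p))))
        (solve 1 (λ s → :0 :- s := :1 :- (:1 :+ s)) refl s)
      nonnegs : All (λ b′ → 0# ≤ h b′) bs
      nonnegs = All.map (λ q → nonneg q (node b) (inside p)) ps
      zeros : All (λ q → eval q (node b) ≡ 0#) (family bs)
      zeros = All.map (λ (0≤q , q≤s) → ≤-antisym (≤-trans q≤s s≤0) 0≤q)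
        (family-small nonnegs (∑≤half⇒Small nonnegs
          (≤-trans (+-mono-≤ s≤0 s≤0) (≤-trans (≤-reflexive (+-identityˡ 0#)) 0≤1))))
      rest = family-apart ps (λ x x-in → ≤-trans (x≤y+x (nonneg p x x-in)) (l x x-in))

  record Family (d m : ℕ) (M : ℝ) : Set where
    field
      polys     : List Poly
      size      : length polys ≡ 2 ℕ.^ m
      degrees   : All (Degree≤ d) polys
      apart     : AllPairs (λ p q → ∃ λ z → In[-1,1] z × eval p z - eval q z ≡ M) polys
      twoValued : ∀ x → In[-1,1] x → ∃ λ u → All (λ p →
        (0# ≤ eval p x × eval p x ≤ 1#) ⊎ (u ≤ eval p x × eval p x ≤ u + 1#)) polys

  spikes : ∀ {d D m} k → Bumps D m → suc k ℕ.* D ℕ.≤ d → Family d m ((1# + 1#) ^ k)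
  spikes {d} {D} k B kD≤d = record
    { polys     = family bumps
    ; size      = trans (length-family bumps) (cong (2 ℕ.^_) number)
    ; degrees   = All.map (λ {p} l → length⇒Degree≤ p (ℕₚ.≤-trans l (s≤s kD≤d))) (family-length isBump)
    ; apart     = family-apart isBump sum≤1
    ; twoValued = λ x x-in →
        let open At x; (u , two) = family-twoValued (All.map (λ p → nonneg p x x-in) isBump) (sum≤1 x x-in) in
        u , All.map (λ { (inj₁ (p , q)) → inj₁ (p , ≤-trans q (sum≤1 x x-in))
                       ; (inj₂ (p , q)) → inj₂ (p , ≤-trans q (+-mono-≤ ≤-refl (sum≤1 x x-in))) }) two
    }
    where
    open Bumps B
    open Spikes B k

-- Choice of the parameters, and Lipschitz bounds for polynomials.

module Construction (em : ExcludedMiddle 0ℓ) (R : CompleteOrderedField) where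
  open Regression em R
  open Reals em R
  open Polynomials em R
  open Families em R

  -- The integer part s of the square root of C, found by descending from some n ≥ C, where C <
  -- (n+1)² holds.
  integerRoot : ∀ {C} → 0# ≤ C → ∃ λ s → fromℕ s * fromℕ s ≤ C × C < fromℕ (suc s) * fromℕ (suc s)
  integerRoot {C} 0≤C = search (proj₁ (archimedean C))
    (≤-<-trans (proj₂ (archimedean C)) (n<[1+n]² (proj₁ (archimedean C))))
    where
    n<[1+n]² : ∀ n → fromℕ n < fromℕ (suc n) * fromℕ (suc n)
    n<[1+n]² n = <-≤-trans (≱⇒< (λ p → ℕₚ.<-irrefl refl (fromℕ-cancel-≤ {suc n} {n} p)))
      (slack (*-nonNeg (0≤fromℕ (suc n)) (0≤fromℕ n))
        (solve 1 (λ n → (:1 :+ n) :* (:1 :+ n) :- (:1 :+ n) := (:1 :+ n) :* n) refl (fromℕ n)))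
    search : ∀ n → C < fromℕ (suc n) * fromℕ (suc n) →
      ∃ λ s → fromℕ s * fromℕ s ≤ C × C < fromℕ (suc s) * fromℕ (suc s)
    search n C< with em {fromℕ n * fromℕ n ≤ C}
    ... | yes p = n , p , C<
    search zero    C< | no ¬p = ⊥-elim (¬p (subst (_≤ C) (sym (zeroˡ 0#)) 0≤C))
    search (suc n) C< | no ¬p = search n (≱⇒< ¬p)

  n<2^n : ∀ n → n ℕ.< 2 ℕ.^ n
  n<2^n zero    = s≤s z≤n
  n<2^n (suc n) = ℕₚ.≤-trans (ℕₚ.+-mono-≤ (ℕₚ.≤-trans (s≤s z≤n) (n<2^n n)) (n<2^n n))
    (ℕₚ.≤-reflexive (cong (2 ℕ.^ n ℕ.+_) (sym (ℕₚ.+-identityʳ _))))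

  -- A spike has degree at most (k+1) 2^(r+1), which must fit into d. The descent stops at the first
  -- r for which doubling once more would pass d, hence the lower bound on r up to a factor 4. At r
  -- = 0 the fit is not guaranteed, and `constantBump` takes over.
  dyadicScale : ∀ d k → ∃ λ r → d ℕ.≤ suc k ℕ.* 2 ℕ.^ (2 ℕ.+ r) × (r ≡ 0 ⊎ suc k ℕ.* 2 ℕ.^ suc r ℕ.≤ d)
  dyadicScale d k = search d (ℕₚ.≤-trans (ℕₚ.<⇒≤ (n<2^n d))
    (ℕₚ.≤-trans (ℕₚ.^-monoʳ-≤ 2 (ℕₚ.m≤n+m d 2)) (ℕₚ.m≤n*m _ (suc k))))
    where
    search : ∀ n → d ℕ.≤ suc k ℕ.* 2 ℕ.^ (2 ℕ.+ n) → ∃ λ r →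
      d ℕ.≤ suc k ℕ.* 2 ℕ.^ (2 ℕ.+ r) × (r ≡ 0 ⊎ suc k ℕ.* 2 ℕ.^ suc r ℕ.≤ d)
    search zero    p = 0 , p , inj₁ refl
    search (suc n) p with d ℕ.≤? suc k ℕ.* 2 ℕ.^ (2 ℕ.+ n)
    ... | yes q = search n q
    ... | no ¬q = suc n , p , inj₂ (ℕₚ.<⇒≤ (ℕₚ.≰⇒> ¬q))

  rate : ℝ
  rate = (fromℕ 28) ⁻¹

  0<rate : 0# < rate
  0<rate = 0<⁻¹ (0<fromℕ 27)

  record Parameters (d : ℕ) (C : ℝ) : Set where
    field
      m      : ℕ
      M      : ℝ
      -- Twice the radius C σ with σ = 2: no polynomial lies that close to two members that differ
      -- by M somewhere.
      gap    : (1# + 1#) * (C * (1# + 1#)) < M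
      family : Family d m M
      large  : (rate * fromℕ d) / (√ C) ≤ fromℕ m

  /-≤ : ∀ {q n d m} → 0# < q → 0# < n → d ≤ n * (q * m) → n ⁻¹ * d / q ≤ m
  /-≤ {q} {n} {d} {m} 0<q 0<n d≤ = *-cancelˡ-≤ 0<q (*-cancelˡ-≤ 0<n (subst (_≤ n * (q * m))
    (trans (sym (⁻¹-cancelˡ 0<q d)) (trans (cong (q ⁻¹ *_) (sym (⁻¹-cancelˡ 0<n (q * d))))
      (solve 5 (λ i q c n d → i :* (c :* (n :* (q :* d))) := n :* (q :* (c :* d :* i))) refl (q ⁻¹) q (n ⁻¹) n d)))
    d≤))

  *-rescale : ∀ {a b k q m} → 0# ≤ k → 0# ≤ b * m → k ≤ a * q → k * (b * m) ≤ a * b * (q * m)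
  *-rescale {a} {b} {k} {q} {m} 0≤k 0≤bm k≤ = ≤-trans (*-mono-≤ 0≤k 0≤bm k≤ ≤-refl)
    (≤-reflexive (solve 4 (λ a q b m → a :* q :* (b :* m) := a :* b :* (q :* m)) refl a q b m))

  module _ {C : ℝ} (1≤C : 1# ≤ C) (s : ℕ) (s²≤C : fromℕ s * fromℕ s ≤ C)
    (C<[1+s]² : C < fromℕ (suc s) * fromℕ (suc s)) where
    private
      k = 2 ℕ.+ (suc s ℕ.+ suc s)
      0≤C = ≤-trans 0≤1 1≤C
      1≤√C : 1# ≤ √ C
      1≤√C = √-upper 0≤C (≤-trans (≤-reflexive (*-identityˡ 1#)) 1≤C)
      t = 1# + 1#

    -- 4C < 4(s+1)² ≤ 4 (2^(s+1))² = 2^k. The crude bound s + 1 ≤ 2^(s+1) is affordable, since it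
    -- keeps k linear in √C.
    height-gap : t * (C * t) < t ^ k
    height-gap = subst₂ _<_ (solve 2 (λ t C → t :* t :* C := t :* (C :* t)) refl t C)
      (trans (solve 2 (λ t a → t :* t :* (a :* a) := t :* (t :* (a :* a))) refl t (t ^ suc s))
        (cong (λ z → t * (t * z)) (sym (^-homo-+ t (suc s) (suc s)))))
      (*-monoˡ-< (0<* 0<2 0<2) (<-≤-trans C<[1+s]²
        (*-mono-≤ (0≤fromℕ (suc s)) (0≤fromℕ (suc s)) 1+s≤t^s 1+s≤t^s)))
      where
      1+s≤t^s : fromℕ (suc s) ≤ t ^ suc s
      1+s≤t^s = subst (fromℕ (suc s) ≤_) (trans (fromℕ-^ 2 (suc s))
        (cong (_^ suc s) (cong (1# +_) (+-identityʳ 1#))))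
        (fromℕ-mono (ℕₚ.<⇒≤ (n<2^n (suc s))))

    -- Here k + 1 = 2s + 5, with s ≤ √C and 1 ≤ √C.
    k<7√C : fromℕ (suc k) ≤ fromℕ 7 * √ C
    k<7√C = subst (_≤ fromℕ 7 * √ C) (sym K) (slack
      (0≤+ (0≤+ (≤⇒0≤ s≤√C) (≤⇒0≤ s≤√C)) (*-nonNeg (0≤fromℕ 5) (≤⇒0≤ 1≤√C)))
      (solve 2 (λ s q → (:1 :+ (:1 :+ five)) :* q :- (s :+ s :+ five)
        := q :- s :+ (q :- s) :+ five :* (q :- :1)) refl (fromℕ s) (√ C)))
      where
      s≤√C : fromℕ s ≤ √ C
      s≤√C = √-upper 0≤C s²≤C
      five : Polynomial 2
      five = :1 :+ (:1 :+ (:1 :+ (:1 :+ (:1 :+ :0))))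
      K : fromℕ (suc k) ≡ (fromℕ s + fromℕ s) + fromℕ 5
      K = trans (cong fromℕ (trans (cong (λ z → suc (suc (suc (suc z)))) (ℕₚ.+-suc s s)) (ℕₚ.+-comm 5 (s ℕ.+ s))))
        (trans (fromℕ-+ (s ℕ.+ s) 5) (cong (_+ fromℕ 5) (fromℕ-+ s s)))

    -- 28 = 7 · 4, with 7 from the bound on k and 4 from the rounding to a power of two.
    rate-bound : ∀ d r → d ℕ.≤ suc k ℕ.* 2 ℕ.^ (2 ℕ.+ r) → (rate * fromℕ d) / (√ C) ≤ fromℕ (2 ℕ.^ r)
    rate-bound d r d≤ = /-≤ (<-≤-trans 0<1 1≤√C) (0<fromℕ 27) (≤-trans (≤-trans (fromℕ-mono d≤) (≤-reflexive 4m))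
      (subst (λ z → fromℕ (suc k) * (fromℕ 4 * fromℕ (2 ℕ.^ r)) ≤ z * (√ C * fromℕ (2 ℕ.^ r))) (sym (fromℕ-* 7 4))
        (*-rescale (0≤fromℕ (suc k)) (*-nonNeg (0≤fromℕ 4) (0≤fromℕ (2 ℕ.^ r))) k<7√C)))
      where
      4m : fromℕ (suc k ℕ.* 2 ℕ.^ (2 ℕ.+ r)) ≡ fromℕ (suc k) * (fromℕ 4 * fromℕ (2 ℕ.^ r))
      4m = trans (fromℕ-* (suc k) (2 ℕ.^ (2 ℕ.+ r))) (cong (fromℕ (suc k) *_)
        (trans (cong fromℕ (sym (ℕₚ.*-assoc 2 2 (2 ℕ.^ r)))) (fromℕ-* 4 (2 ℕ.^ r))))

  spikes-of-degree : ∀ {d} k r → r ≡ 0 ⊎ suc k ℕ.* 2 ℕ.^ suc r ℕ.≤ d → Family d (2 ℕ.^ r) ((1# + 1#) ^ k)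
  spikes-of-degree k r (inj₂ p)        = spikes k (chebyshevBumps r) p
  spikes-of-degree {d} k .0 (inj₁ refl) = spikes k constantBump (subst (ℕ._≤ d) (sym (ℕₚ.*-zeroʳ k)) z≤n)

  parameters : ∀ d C → 1# ≤ C → Parameters d C
  parameters d C 1≤C = choose (integerRoot (≤-trans 0≤1 1≤C))
    where
    choose : (∃ λ s → fromℕ s * fromℕ s ≤ C × C < fromℕ (suc s) * fromℕ (suc s)) → Parameters d C
    choose (s , s²≤C , C<[1+s]²) =
      let k = 2 ℕ.+ (suc s ℕ.+ suc s)
          (r , d≤ , r≤) = dyadicScale d k
      in record
        { m      = 2 ℕ.^ r
        ; M      = (1# + 1#) ^ k
        ; gap    = height-gap 1≤C s s²≤C C<[1+s]²
        ; family = spikes-of-degree k r r≤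
        ; large  = rate-bound 1≤C s s²≤C C<[1+s]² d r d≤
        }

  -- The bound on the absolute value as two linear inequalities, which suit slack arguments and
  -- avoid the case split in `∣_∣`.
  Within : ℝ → ℝ → Set
  Within b z = z ≤ b × - z ≤ b

  within-+ : ∀ {a b y z} → Within a y → Within b z → Within (a + b) (y + z)
  within-+ {a} {b} {y} {z} (p , q) (p′ , q′) = +-mono-≤ p p′ ,
    ≤-trans (≤-reflexive (solve 2 (λ y z → :- (y :+ z) := (:- y) :+ (:- z)) refl y z)) (+-mono-≤ q q′)

  within-* : ∀ {a b y z} → Within a y → Within b z → Within (a * b) (y * z)
  within-* {a} {b} {y} {z} (p , q) (p′ , q′) =
    *-cancelˡ-≤ 0<2 (slack (0≤+ (*-nonNeg (≤⇒0≤ p) (≤⇒0≤ q′)) (*-nonNeg (≤⇒0≤ q) (≤⇒0≤ p′)))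
      (solve 4 (λ a b y z → (:1 :+ :1) :* (a :* b) :- (:1 :+ :1) :* (y :* z)
        := (a :- y) :* (b :- :- z) :+ (a :- :- y) :* (b :- z)) refl a b y z)) ,
    *-cancelˡ-≤ 0<2 (slack (0≤+ (*-nonNeg (≤⇒0≤ p) (≤⇒0≤ p′)) (*-nonNeg (≤⇒0≤ q) (≤⇒0≤ q′)))
      (solve 4 (λ a b y z → (:1 :+ :1) :* (a :* b) :- (:1 :+ :1) :* (:- (y :* z))
        := (a :- y) :* (b :- z) :+ (a :- :- y) :* (b :- :- z)) refl a b y z))

  within-∣∣ : ∀ z → Within ∣ z ∣ z
  within-∣∣ z = x≤∣x∣ z , -x≤∣x∣ z

  within-≤ : ∀ {a b z} → a ≤ b → Within a z → Within b z
  within-≤ a≤b (p , q) = ≤-trans p a≤b , ≤-trans q a≤b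

  within-1 : ∀ {x} → In[-1,1] x → Within 1# x
  within-1 {x} (p , q) = q , slack (≤⇒0≤ p) (solve 1 (λ x → :1 :- :- x := x :- :- :1) refl x)

  eval-bounded : ∀ p → ∃ λ b → ∀ x → In[-1,1] x → Within b (eval p x)
  eval-bounded []      = 0# , λ _ _ → ≤-refl , ≤-reflexive (solve 0 (:- :0 := :0) refl)
  eval-bounded (a ∷ p) = ∣ a ∣ + 1# * proj₁ (eval-bounded p) , λ x x-in →
    within-+ (within-∣∣ a) (within-* (within-1 x-in) (proj₂ (eval-bounded p) x x-in))

  Lipschitz : ℝ → Poly → Set
  Lipschitz K p = ∀ x y → In[-1,1] x → In[-1,1] y → y ≤ x → Within (K * (x - y)) (eval p x - eval p y)

  0≤within : ∀ {b z} → Within b z → 0# ≤ b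
  0≤within {b} {z} (p , q) = *-cancelˡ-≤ 0<2 (slack (0≤+ (≤⇒0≤ p) (≤⇒0≤ q))
    (solve 2 (λ b z → (:1 :+ :1) :* b :- (:1 :+ :1) :* :0 := b :- z :+ (b :- :- z)) refl b z))

  -- Induction along the Horner form: xu - yv = x(u - v) + (x - y)v, so the constant grows by a
  -- bound for the tail of p on [-1,1].
  lipschitz : ∀ p → ∃ λ K → 0# ≤ K × Lipschitz K p
  lipschitz []      = 0# , ≤-refl , λ x y _ _ _ →
    ≤-reflexive (solve 2 (λ x y → :0 :- :0 := :0 :* (x :- y)) refl x y) ,
    ≤-reflexive (solve 2 (λ x y → :- (:0 :- :0) := :0 :* (x :- y)) refl x y)
  lipschitz (a ∷ p) = K + b , 0≤+ 0≤K (0≤within (bounded 0# 0-inside)) , λ x y x-in y-in y≤x →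
    subst₂ Within
      (solve 4 (λ K b x y → :1 :* (K :* (x :- y)) :+ (x :- y) :* b := (K :+ b) :* (x :- y)) refl K b x y)
      (solve 5 (λ a x y u v → x :* (u :- v) :+ (x :- y) :* v := (a :+ x :* u) :- (a :+ y :* v))
        refl a x y (eval p x) (eval p y))
      (within-+ (within-* (within-1 x-in) (lip x y x-in y-in y≤x))
        (within-* (≤-refl , slack (0≤+ (≤⇒0≤ y≤x) (≤⇒0≤ y≤x))
            (solve 2 (λ x y → (x :- y) :- :- (x :- y) := x :- y :+ (x :- y)) refl x y)) (bounded y y-in)))
    where
    K   = proj₁ (lipschitz p)
    0≤K = proj₁ (proj₂ (lipschitz p))
    lip = proj₂ (proj₂ (lipschitz p))
    b   = proj₁ (eval-bounded p)
    bounded = proj₂ (eval-bounded p)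

  lipschitz-All : ∀ ps → ∃ λ K → 0# ≤ K × All (Lipschitz K) ps
  lipschitz-All []       = 0# , ≤-refl , []
  lipschitz-All (p ∷ ps) with lipschitz p | lipschitz-All ps
  ... | K , 0≤K , l | K′ , 0≤K′ , ls = K + K′ , 0≤+ 0≤K 0≤K′ ,
    (λ x y x-in y-in y≤x → within-≤ (widen (x≤x+y 0≤K′) y≤x) (l x y x-in y-in y≤x)) ∷
    All.map (λ l x y x-in y-in y≤x → within-≤ (widen (x≤y+x 0≤K) y≤x)
      (l x y x-in y-in y≤x)) ls
    where
    widen : ∀ {a b x y} → a ≤ b → y ≤ x → a * (x - y) ≤ b * (x - y)
    widen {a} {b} p q = subst₂ _≤_ (*-comm _ a) (*-comm _ b) (*-monoˡ-≤ _ (≤⇒0≤ q) p)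

-- Measurable maps, and rounding to a finite grid.

module Measurability (em : ExcludedMiddle 0ℓ) (R : CompleteOrderedField) where
  open Regression em R
  open Reals em R
  open Polynomials em R
  open Families em R
  open Construction em R
  open MeasurableSpace using (Carrier; Measurable)

  module _ (M : MeasurableSpace) where
    private module 𝓜 = MeasurableSpace M

    ∅-measurable : Measurable M ∅
    ∅-measurable = 𝓜.resp-≐ ((λ ¬u → ¬u _) , λ ()) (𝓜.compl 𝓜.univ)

    ∪-measurable : ∀ {A B} → Measurable M A → Measurable M B → Measurable M (A ∪ B)
    ∪-measurable {A} {B} a b = 𝓜.resp-≐ ((λ { (zero , x) → inj₁ x ; (suc _ , x) → inj₂ x }) ,
                                       λ { (inj₁ x) → 0 , x ; (inj₂ x) → 1 , x })
      (𝓜.union {A = λ { zero → A ; (suc _) → B }} (λ { zero → a ; (suc _) → b }))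

    ∩-measurable : ∀ {A B} → Measurable M A → Measurable M B → Measurable M (A ∩ B)
    ∩-measurable {A} {B} a b = 𝓜.resp-≐ ((λ {x} → to x) , λ (x , y) → [ (λ ¬x → ¬x x) , (λ ¬y → ¬y y) ]′)
      (𝓜.compl (∪-measurable (𝓜.compl a) (𝓜.compl b)))
      where
      to : ∀ x → ∁ (∁ A ∪ ∁ B) x → (A ∩ B) x
      to x n with em {A x} | em {B x}
      ... | yes p | yes q = p , q
      ... | no ¬p | _     = ⊥-elim (n (inj₁ ¬p))
      ... | yes _ | no ¬q = ⊥-elim (n (inj₂ ¬q))

    const-measurable : (P : Set) → Measurable M (λ _ → P)
    const-measurable P with em {P}
    ... | yes p = 𝓜.resp-≐ ((λ _ → p) , λ _ → _) 𝓜.univ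
    ... | no ¬p = 𝓜.resp-≐ ((λ ()) , ¬p) ∅-measurable

    generated-measurable : ∀ {X} {G : Pred X 0ℓ → Set₁} {f : Carrier M → X} →
      (∀ {B} → G B → Measurable M (f ⊢ B)) → IsMeasurable M σ⟨ G ⟩ f
    generated-measurable g (base b)               = g b
    generated-measurable g (resp-≐ (l , r) b)     = 𝓜.resp-≐ (l , r) (generated-measurable g b)
    generated-measurable g univ                   = 𝓜.univ
    generated-measurable g (compl b)              = 𝓜.compl (generated-measurable g b)
    generated-measurable g (union b)              = 𝓜.union (λ i → generated-measurable g (b i))

    pair-measurable : ∀ {N N′ f g} → IsMeasurable M N f → IsMeasurable M N′ g →
                      IsMeasurable M (N ⊗ N′) (λ x → f x , g x)
    pair-measurable {N} {N′} {f} {g} mf mg = generated-measurable λ { (fst a) → mf a ; (snd b) → mg b }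

    lookup-measurable : ∀ {N n xs} → IsMeasurable M (Vecᵐ N n) xs → ∀ i → IsMeasurable M N (λ ω → lookup (xs ω) i)
    lookup-measurable mxs i b = mxs (base (coord i b))

    vec-measurable : ∀ {N n xs} → (∀ i → IsMeasurable M N (λ ω → lookup (xs ω) i)) → IsMeasurable M (Vecᵐ N n) xs
    vec-measurable m = generated-measurable λ { (coord i a) → m i a }

    Bits : ∀ {n} → (Carrier M → Vec Bool n) → Set₁
    Bits g = ∀ i b → Measurable M (λ ω → lookup (g ω) i ≡ b)

    bits : ∀ {n g} → IsMeasurable M (Vecᵐ Boolᵐ n) g → Bits g
    bits mg i b = lookup-measurable mg i (base (singleton b))

    bits-≡ : ∀ {n} {g : Carrier M → Vec Bool n} → Bits g → ∀ v → Measurable M (g ⊢ (_≡ v))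
    bits-≡ {zero}  {g} mg [] = 𝓜.resp-≐ ((λ {ω} _ → nil (g ω)) , λ _ → _) 𝓜.univ
      where
      nil : (v : Vec Bool 0) → v ≡ []
      nil [] = refl
    bits-≡ {suc n} {g} mg (b ∷ v) = 𝓜.resp-≐ ((λ {ω} → to (g ω)) , λ e → cong Vec.head e , cong Vec.tail e)
      (∩-measurable (𝓜.resp-≐ ((λ {ω} → trans (head≡ (g ω))) , λ {ω} → trans (sym (head≡ (g ω)))) (mg zero b))
        (bits-≡ {g = λ ω → Vec.tail (g ω)} (λ i c → 𝓜.resp-≐
          ((λ {ω} → trans (tail≡ (g ω) i)) , λ {ω} → trans (sym (tail≡ (g ω) i))) (mg (suc i) c)) v))
      where
      head≡ : ∀ (u : Vec Bool (suc n)) → Vec.head u ≡ lookup u zero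
      head≡ (_ ∷ _) = refl
      tail≡ : ∀ (u : Vec Bool (suc n)) i → lookup (Vec.tail u) i ≡ lookup u (suc i)
      tail≡ (_ ∷ _) i = refl
      to : ∀ (u : Vec Bool (suc n)) → Vec.head u ≡ b × Vec.tail u ≡ v → u ≡ b ∷ v
      to (_ ∷ _) (refl , refl) = refl

    -- Measurability of φ in the real argument suffices, one bit at a time: each preimage splits
    -- into two pieces according to the bit.
    zipWith-measurable : ∀ {N n} {xs : Carrier M → Vec ℝ n} {o : Carrier M → Vec Bool n}
      (φ : ℝ → Bool → Carrier N) →
      IsMeasurable M (Vecᵐ Borel n) xs → Bits o → (∀ b → IsMeasurable Borel N (λ x → φ x b)) →
      IsMeasurable M (Vecᵐ N n) (λ ω → zipWith φ (xs ω) (o ω))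
    zipWith-measurable {N} {n} {xs} {o} φ mxs mo mφ = vec-measurable λ i {B} mB →
      𝓜.resp-≐ ((λ {ω} → to i B ω) , λ {ω} → from i B ω)
        (∪-measurable (case i true mB) (case i false mB))
      where
      Case : Fin n → (B : Pred (Carrier N) 0ℓ) → Bool → Pred (Carrier M) 0ℓ
      Case i B b = (λ ω → lookup (o ω) i ≡ b) ∩ (λ ω → B (φ (lookup (xs ω) i) b))
      case : ∀ i b {B} → Measurable N B → Measurable M (Case i B b)
      case i b mB = ∩-measurable (mo i b) (lookup-measurable mxs i (mφ b mB))
      to : ∀ i B ω → (Case i B true ∪ Case i B false) ω → B (lookup (zipWith φ (xs ω) (o ω)) i)
      to i B ω = λ { (inj₁ (e , p)) → back e p ; (inj₂ (e , p)) → back e p }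
        where
        back : ∀ {b} → lookup (o ω) i ≡ b → B (φ (lookup (xs ω) i) b) → B (lookup (zipWith φ (xs ω) (o ω)) i)
        back e p = subst B (sym (trans (Vecₚ.lookup-zipWith φ i (xs ω) (o ω)) (cong (φ _) e))) p
      from : ∀ i B ω → B (lookup (zipWith φ (xs ω) (o ω)) i) → (Case i B true ∪ Case i B false) ω
      from i B ω p = split _ refl (subst B (Vecₚ.lookup-zipWith φ i (xs ω) (o ω)) p)
        where
        split : ∀ b → lookup (o ω) i ≡ b → B (φ (lookup (xs ω) i) (lookup (o ω) i)) →
          (Case i B true ∪ Case i B false) ω
        split true  e q = inj₁ (e , subst (λ b → B (φ _ b)) e q)
        split false e q = inj₂ (e , subst (λ b → B (φ _ b)) e q)

    zip-measurable : ∀ {N N′ n xs ys} → IsMeasurable M (Vecᵐ N n) xs → IsMeasurable M (Vecᵐ N′ n) ys →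
                     IsMeasurable M (Vecᵐ (N ⊗ N′) n) (λ ω → zip (xs ω) (ys ω))
    zip-measurable {N} {N′} {n} {xs} {ys} mxs mys = vec-measurable λ i {B} mB →
      𝓜.resp-≐
        ((λ {ω} → subst B (sym (Vecₚ.lookup-zip i (xs ω) (ys ω))))
        , λ {ω} → subst B (Vecₚ.lookup-zip i (xs ω) (ys ω)))
        (pair-measurable {N} {N′} (lookup-measurable {N} mxs i) (lookup-measurable {N′} mys i) mB)

  -- Preimages of arbitrary predicates, not only of Borel sets, are required to be Borel. Hence
  -- anything computed from the value of f is measurable, even if it was chosen by excluded middle.
  Discrete : (ℝ → ℝ) → Set₁
  Discrete f = ∀ P → Measurable Borel (f ⊢ P)

  module Grid (N : ℕ) where
    δ : ℝ
    δ = fromℕ (suc N) ⁻¹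

    grid : ℕ → ℝ
    grid i = - 1# + fromℕ i * δ

    roundDown : ℕ → ℝ → ℝ
    roundDown zero    x = - 1#
    roundDown (suc i) x with em {x ≤ grid i}
    ... | yes _ = roundDown i x
    ... | no  _ = grid i

    roundDown-discrete : ∀ i → Discrete (roundDown i)
    roundDown-discrete zero    P = const-measurable Borel (P (- 1#))
    roundDown-discrete (suc i) P = resp-≐ ((λ {x} → to x) , λ {x} → from x)
      (∪-measurable Borel (∩-measurable Borel (base (ray (grid i))) (roundDown-discrete i P))
        (∩-measurable Borel (compl (base (ray (grid i)))) (const-measurable Borel (P (grid i)))))
      where
      Cases : Pred ℝ 0ℓ
      Cases = ((_≤ grid i) ∩ (roundDown i ⊢ P)) ∪ (∁ (_≤ grid i) ∩ λ _ → P (grid i))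
      to : ∀ x → Cases x → P (roundDown (suc i) x)
      to x c with em {x ≤ grid i}
      to x (inj₁ (_ , p))  | yes _ = p
      to x (inj₂ (¬l , _)) | yes l = ⊥-elim (¬l l)
      to x (inj₁ (l , _))  | no ¬l = ⊥-elim (¬l l)
      to x (inj₂ (_ , p))  | no _  = p
      from : ∀ x → P (roundDown (suc i) x) → Cases x
      from x p with em {x ≤ grid i}
      ... | yes l = inj₁ (l , p)
      ... | no ¬l = inj₂ (¬l , p)

    0≤δ : 0# ≤ δ
    0≤δ = 0≤⁻¹ (0<fromℕ N)

    roundDown-close : ∀ i x → - 1# ≤ x → x ≤ grid i →
      - 1# ≤ roundDown i x × roundDown i x ≤ x × x - roundDown i x ≤ δ
    roundDown-close zero x -1≤x x≤ = ≤-refl , -1≤x , slack (0≤+ 0≤δ (≤⇒0≤ x≤))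
      (solve 2 (λ x δ → δ :- (x :- :- :1) := δ :+ ((:- :1 :+ :0 :* δ) :- x)) refl x δ)
    roundDown-close (suc i) x -1≤x x≤ with em {x ≤ grid i}
    ... | yes l = roundDown-close i x -1≤x l
    ... | no ¬l = x≤x+y (*-nonNeg (0≤fromℕ i) 0≤δ)
      , ≮⇒≥ ¬l , slack (≤⇒0≤ x≤)
      (solve 3 (λ x δ n → δ :- (x :- (:- :1 :+ n :* δ)) := (:- :1 :+ (:1 :+ n) :* δ) :- x) refl x δ (fromℕ i))

    -- 2(N+1) steps of length 1/(N+1) lead from -1 to 1.
    top : ℕ
    top = suc N ℕ.+ suc N

    grid-top : grid top ≡ 1#
    grid-top = trans (cong (λ z → - 1# + z * δ) (fromℕ-+ (suc N) (suc N)))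
      (trans (solve 2 (λ n i → :- :1 :+ (n :+ n) :* i := :- :1 :+ (n :* i :+ n :* i)) refl (fromℕ (suc N)) δ)
        (trans (cong (λ z → - 1# + (z + z)) (*-inverse (fromℕ (suc N)) (λ e → proj₂ (0<fromℕ N) (sym e))))
          (solve 0 (:- :1 :+ (:1 :+ :1) := :1) refl)))

  record Rounding (ps : List Poly) : Set₁ where
    field
      round    : ℝ → ℝ
      discrete : Discrete round
      inside   : ∀ x → In[-1,1] x → In[-1,1] (round x)
      close    : ∀ x → In[-1,1] x → All (λ p → Within 1# (eval p x - eval p (round x))) ps

  -- With N at least a common Lipschitz constant K, the spacing 1/(N+1) gives K/(N+1) ≤ 1.
  rounding : ∀ ps → Rounding ps
  rounding ps with lipschitz-All ps
  ... | K , 0≤K , lips with archimedean K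
  ...   | N , K≤N = record
    { round    = roundDown top
    ; discrete = roundDown-discrete top
    ; inside   = λ x x-in → proj₁ (near x x-in) , ≤-trans (proj₁ (proj₂ (near x x-in))) (proj₂ x-in)
    ; close    = λ x x-in → let (lo , le , gap) = near x x-in in
        All.map (λ lip → within-≤ (small gap (≤⇒0≤ le)) (lip x _ x-in (lo , ≤-trans le (proj₂ x-in)) le)) lips
    }
    where
    open Grid N
    near = λ x (x-in : In[-1,1] x) → roundDown-close top x (proj₁ x-in)
      (≤-trans (proj₂ x-in) (≤-reflexive (sym grid-top)))
    small : ∀ {z} → z ≤ δ → 0# ≤ z → K * z ≤ 1#
    small z≤ 0≤z = ≤-trans (*-mono-≤ 0≤K 0≤z (≤-trans K≤N (fromℕ-mono (ℕₚ.n≤1+n N))) z≤)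
      (≤-reflexive (*-inverse (fromℕ (suc N)) (λ e → proj₂ (0<fromℕ N) (sym e))))

-- Probability of finite unions, counting, and expectation.

module Probability (em : ExcludedMiddle 0ℓ) (R : CompleteOrderedField) where
  open Regression em R
  open Reals em R
  open Polynomials em R
  open Measurability em R
  open MeasurableSpace using (Carrier; Measurable)

  ∑ᵇ : ∀ n → (Vec Bool n → ℝ) → ℝ
  ∑ᵇ zero    f = f []
  ∑ᵇ (suc n) f = ∑ᵇ n (f ∘ (true ∷_)) + ∑ᵇ n (f ∘ (false ∷_))

  ∑ᵇ-cong : ∀ n {f g} → (∀ v → f v ≡ g v) → ∑ᵇ n f ≡ ∑ᵇ n g
  ∑ᵇ-cong zero    e = e []
  ∑ᵇ-cong (suc n) e = cong₂ _+_ (∑ᵇ-cong n (e ∘ (true ∷_))) (∑ᵇ-cong n (e ∘ (false ∷_)))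

  ∑ᵇ-*ˡ : ∀ n c f → ∑ᵇ n (λ v → c * f v) ≡ c * ∑ᵇ n f
  ∑ᵇ-*ˡ zero    c f = refl
  ∑ᵇ-*ˡ (suc n) c f = trans (cong₂ _+_ (∑ᵇ-*ˡ n c _) (∑ᵇ-*ˡ n c _))
    (solve 3 (λ c a b → c :* a :+ c :* b := c :* (a :+ b)) refl c _ _)

  IsLub-unique : ∀ {S s t} → IsLub S s → IsLub S t → s ≡ t
  IsLub-unique (u , l) (u′ , l′) = ≤-antisym (l _ u′) (l′ _ u)

  Monotone : (ℕ → ℝ) → Set
  Monotone a = ∀ m n → m ℕ.≤ n → a m ≤ a n

  -- For a m + b n with different indices, both are raised to the maximum of m and n, which
  -- monotonicity allows.
  IsLub-+ : ∀ {a b α β} → Monotone a → Monotone b → IsLub (Range a) α → IsLub (Range b) β →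
            IsLub (Range (λ n → a n + b n)) (α + β)
  IsLub-+ {a} {b} {α} {β} ma mb (ua , la) (ub , lb) =
    (λ { _ (n , refl) → +-mono-≤ (ua _ (n , refl)) (ub _ (n , refl)) }) ,
    λ s us → slack (≤⇒0≤ (la (s - β) λ { _ (m , refl) →
        slack (≤⇒0≤ (lb (s - a m) λ { _ (n , refl) →
          slack (≤⇒0≤ (≤-trans (+-mono-≤ (ma m (m ℕ.⊔ n) (ℕₚ.m≤m⊔n m n)) (mb n (m ℕ.⊔ n) (ℕₚ.m≤n⊔m m n)))
            (us _ (m ℕ.⊔ n , refl))))
            (solve 3 (λ s a b → s :- a :- b := s :- (a :+ b)) refl s (a m) (b n)) }))
          (solve 3 (λ s a β → s :- β :- a := s :- a :- β) refl s (a m) β) }))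
      (solve 3 (λ s α β → s :- (α :+ β) := s :- β :- α) refl s α β)

  ∑<-monotone : ∀ {f} → (∀ k → 0# ≤ f k) → Monotone (λ n → ∑< n f)
  ∑<-monotone {f} p m n m≤n = subst (λ k → ∑< m f ≤ ∑< k f) (ℕₚ.m∸n+n≡m m≤n) (grow (n ℕ.∸ m))
    where
    grow : ∀ k → ∑< m f ≤ ∑< (k ℕ.+ m) f
    grow zero    = ≤-refl
    grow (suc k) = ≤-trans (grow k) (x≤x+y (p (k ℕ.+ m)))

  ∑-mono : ∀ {A : Set} {f g : A → ℝ} as → (∀ a → f a ≤ g a) → ∑ as f ≤ ∑ as g
  ∑-mono []       p = ≤-refl
  ∑-mono (a ∷ as) p = +-mono-≤ (p a) (∑-mono as p)

  ∑-cong : ∀ {A : Set} {f g : A → ℝ} as → (∀ a → f a ≡ g a) → ∑ as f ≡ ∑ as g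
  ∑-cong []       e = refl
  ∑-cong (a ∷ as) e = cong₂ _+_ (e a) (∑-cong as e)

  ∑-+ : ∀ {A : Set} (as : List A) (f g : A → ℝ) → ∑ as (λ a → f a + g a) ≡ ∑ as f + ∑ as g
  ∑-+ []       f g = sym (+-identityˡ 0#)
  ∑-+ (a ∷ as) f g = trans (cong (f a + g a +_) (∑-+ as f g))
    (solve 4 (λ a b c d → a :+ b :+ (c :+ d) := a :+ c :+ (b :+ d)) refl (f a) (g a) (∑ as f) (∑ as g))

  ∑-∑< : ∀ {A : Set} as n (f : A → ℕ → ℝ) → ∑ as (λ a → ∑< n (f a)) ≡ ∑< n (λ k → ∑ as (λ a → f a k))
  ∑-∑< as zero f = zeros as
    where
    zeros : ∀ {A : Set} (as : List A) → ∑ as (λ _ → 0#) ≡ 0#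
    zeros []       = refl
    zeros (a ∷ as) = trans (+-identityˡ _) (zeros as)
  ∑-∑< as (suc n) f = trans (∑-+ as _ _) (cong (_+ ∑ as (λ a → f a n)) (∑-∑< as n f))

  ∑<-mono : ∀ n {f g} → (∀ k → f k ≤ g k) → ∑< n f ≤ ∑< n g
  ∑<-mono zero    p = ≤-refl
  ∑<-mono (suc n) p = +-mono-≤ (∑<-mono n p) (p n)

  count : {A : Set} → (A → Set) → List A → ℕ
  count P []       = 0
  count P (a ∷ as) with em {P a}
  ... | yes _ = suc (count P as)
  ... | no _  = count P as

  count-yes : ∀ {A : Set} {P : A → Set} {a} as → P a → count P (a ∷ as) ≡ suc (count P as)
  count-yes {P = P} {a} as p with em {P a}
  ... | yes _ = refl
  ... | no ¬p = ⊥-elim (¬p p)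

  count-no : ∀ {A : Set} {P : A → Set} {a} as → ¬ P a → count P (a ∷ as) ≡ count P as
  count-no {P = P} {a} as ¬p with em {P a}
  ... | yes p = ⊥-elim (¬p p)
  ... | no _  = refl

  module _ (P : ProbabilitySpace) where
    open ProbabilitySpace P

    ∩-event : ∀ {A B} → Event A → Event B → Event (A ∩ B)
    ∩-event = ∩-measurable space

    ∁-event : ∀ {A} → Event A → Event (∁ A)
    ∁-event = MeasurableSpace.compl space

    -- Countable additivity for the constant sequence of empty events bounds twice the probability
    -- by the probability itself.
    prob-∅ : prob ∅ ≡ 0#
    prob-∅ = ≤-antisym
      (slack (≤⇒0≤ twice) (solve 1 (λ p → :0 :- p := p :- (:0 :+ p :+ p)) refl (prob ∅))) (nonNeg ∅-event)
      where
      ∅-event = ∅-measurable space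
      isLub = additive {A = λ _ → ∅} (λ _ → ∅-event) (λ _ → λ ())
      twice : 0# + prob ∅ + prob ∅ ≤ prob ∅
      twice = ≤-trans (proj₁ isLub _ (2 , refl))
        (≤-reflexive (sym (cong-≐ ∅-event ((λ ()) , λ ()))))

    -- Binary additivity comes from the countable one by padding with empty events; the partial sums
    -- are constant from the second on.
    prob-split : ∀ {E B} → Event E → Event B → prob E ≡ prob (E ∩ B) + prob (E ∩ ∁ B)
    prob-split {E} {B} e b = trans (cong-≐ e ((λ {x} → to x) , λ {x} → from x))
      (IsLub-unique (additive {A = A} events disjoint) isLub)
      where
      A : ℕ → Pred Ω 0ℓ
      A zero          = E ∩ B
      A (suc zero)    = E ∩ ∁ B
      A (suc (suc _)) = ∅
      events : ∀ i → Event (A i)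
      events zero          = ∩-event e b
      events (suc zero)    = ∩-event e (∁-event b)
      events (suc (suc _)) = ∅-measurable space
      disjoint : ∀ {i j} → i ≢ j → A i ⊥ A j
      disjoint {zero}        {zero}        i≢j _ = i≢j refl
      disjoint {zero}        {suc zero}    _ ((_ , x) , (_ , ¬x)) = ¬x x
      disjoint {suc zero}    {zero}        _ ((_ , ¬x) , (_ , x)) = ¬x x
      disjoint {suc zero}    {suc zero}    i≢j _ = i≢j refl
      disjoint {zero}        {suc (suc _)} _ (_ , ())
      disjoint {suc zero}    {suc (suc _)} _ (_ , ())
      disjoint {suc (suc _)} {_}           _ (() , _)
      to : ∀ x → E x → ⋃ ℕ A x
      to x p with em {B x}
      ... | yes q = 0 , p , q
      ... | no ¬q = 1 , p , ¬q
      from : ∀ x → ⋃ ℕ A x → E x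
      from x (zero        , p , _) = p
      from x (suc zero    , p , _) = p
      from x (suc (suc _) , ())
      p q : ℝ
      p = prob (E ∩ B)
      q = prob (E ∩ ∁ B)
      tail : ∀ n → ∑< (2 ℕ.+ n) (prob ∘ A) ≡ p + q
      tail zero    = solve 2 (λ p q → :0 :+ p :+ q := p :+ q) refl p q
      tail (suc n) = trans (cong₂ _+_ (tail n) prob-∅) (+-identityʳ _)
      isLub : IsLub (Range (λ n → ∑< n (prob ∘ A))) (p + q)
      isLub = (λ { _ (n , refl) → ≤-trans (∑<-monotone (nonNeg ∘ events) n (2 ℕ.+ n) (ℕₚ.m≤n+m n 2))
        (≤-reflexive (tail n)) }) ,
              λ s us → ≤-trans (≤-reflexive (sym (tail 0))) (us _ (2 , refl))

    partition : ∀ {n} {g : Ω → Vec Bool n} → Bits space g → ∀ {E} → Event E →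
                prob E ≡ ∑ᵇ n (λ v → prob (E ∩ (g ⊢ (_≡ v))))
    partition {zero}  {g} mg e = cong-≐ e ((λ {ω} p → p , nil (g ω)) , proj₁)
      where
      nil : (v : Vec Bool 0) → v ≡ []
      nil [] = refl
    partition {suc n} {g} mg {E} e = trans (prob-split e (mg zero true)) (cong₂ _+_
      (branch true (∩-event e (mg zero true)) ((λ p → p) , λ p → p))
      (branch false (∩-event e (∁-event (mg zero true)))
        ((λ (p , ¬t) → p , Boolₚ.¬-not ¬t) , λ (p , f) → p , λ t → true≢false (trans (sym t) f))))
      where
      true≢false : true ≢ false
      true≢false ()
      g′ : Ω → Vec Bool n
      g′ ω = Vec.tail (g ω)
      uncons : ∀ {b} {v : Vec Bool n} (u : Vec Bool (suc n)) → lookup u zero ≡ b → Vec.tail u ≡ v → u ≡ b ∷ v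
      uncons (_ ∷ _) refl refl = refl
      tail≡ : ∀ (u : Vec Bool (suc n)) i → lookup (Vec.tail u) i ≡ lookup u (suc i)
      tail≡ (_ ∷ _) i = refl
      mg′ : Bits space g′
      mg′ i b = MeasurableSpace.resp-≐ space
        ((λ {ω} → trans (tail≡ (g ω) i)) , λ {ω} → trans (sym (tail≡ (g ω) i))) (mg (suc i) b)
      branch : ∀ b {F} → Event F → F ≐ (E ∩ λ ω → lookup (g ω) zero ≡ b) →
               prob F ≡ ∑ᵇ n (λ v → prob (E ∩ (g ⊢ (_≡ b ∷ v))))
      branch b f (l , r) = trans (partition mg′ f) (∑ᵇ-cong n λ v →
        cong-≐ (∩-event f (bits-≡ space mg′ v))
          ( (λ {ω} (p , e) → proj₁ (l p) , uncons (g ω) (proj₂ (l p)) e)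
          , λ {ω} (p , e) → r (p , cong (λ u → lookup u zero) e) , cong Vec.tail e))

    -- Double counting without an integral. G is split by the first event: where that event occurs,
    -- at most k - 1 of the others can, and where it fails, at most k.
    ∑-prob≤ : ∀ {A : Set} (as : List A) {E : A → Pred Ω 0ℓ} → (∀ a → Event (E a)) → ∀ k {G} → Event G →
              (∀ ω → G ω → count (λ a → E a ω) as ℕ.≤ k) → ∑ as (λ a → prob (E a ∩ G)) ≤ fromℕ k * prob G
    ∑-prob≤ []       mE k mG _ = *-nonNeg (0≤fromℕ k) (nonNeg mG)
    ∑-prob≤ (a ∷ as) {E} mE k {G} mG few = ≤-trans (≤-reflexive regroup) (≤-trans (bound k few)
      (≤-reflexive (cong (fromℕ k *_) (sym (prob-split mG (mE a))))))
      where
      G₁ G₂ : Pred Ω 0ℓ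
      G₁ = G ∩ E a
      G₂ = G ∩ ∁ (E a)
      mG₁ = ∩-event mG (mE a)
      mG₂ = ∩-event mG (∁-event (mE a))
      S₁ S₂ : ℝ
      S₁ = ∑ as (λ b → prob (E b ∩ G₁))
      S₂ = ∑ as (λ b → prob (E b ∩ G₂))
      regroup : prob (E a ∩ G) + ∑ as (λ b → prob (E b ∩ G)) ≡ prob G₁ + (S₁ + S₂)
      regroup = cong₂ _+_ (cong-≐ (∩-event (mE a) mG) ((λ (x , y) → y , x) , λ (x , y) → y , x))
        (trans (∑-cong as λ b → trans (prob-split (∩-event (mE b) mG) (mE a)) (cong₂ _+_
          (cong-≐ (∩-event (∩-event (mE b) mG) (mE a))
            ((λ ((x , y) , z) → x , y , z) , λ (x , y , z) → (x , y) , z))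
          (cong-≐ (∩-event (∩-event (mE b) mG) (∁-event (mE a)))
            ((λ ((x , y) , z) → x , y , z) , λ (x , y , z) → (x , y) , z))))
          (∑-+ as _ _))
      few₂ : ∀ k → (∀ ω → G ω → count (λ b → E b ω) (a ∷ as) ℕ.≤ k) → S₂ ≤ fromℕ k * prob G₂
      few₂ k few = ∑-prob≤ as mE k mG₂ λ ω (g , ¬e) → subst (ℕ._≤ k) (count-no as ¬e) (few ω g)
      bound : ∀ k → (∀ ω → G ω → count (λ b → E b ω) (a ∷ as) ℕ.≤ k) →
              prob G₁ + (S₁ + S₂) ≤ fromℕ k * (prob G₁ + prob G₂)
      bound zero few = ≤-trans (+-mono-≤ (≤-reflexive (trans (cong-≐ mG₁ ((λ {ω} → absurd ω) , λ ())) prob-∅))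
          (+-mono-≤ (∑-prob≤ as mE 0 mG₁ λ ω g → ⊥-elim (absurd ω g)) (few₂ 0 few)))
        (≤-reflexive (solve 2 (λ p q → :0 :+ (:0 :* p :+ :0 :* q) := :0 :* (p :+ q)) refl (prob G₁) (prob G₂)))
        where
        absurd : ∀ ω → ¬ G₁ ω
        absurd ω (g , e) with subst (ℕ._≤ 0) (count-yes as e) (few ω g)
        ... | ()
      bound (suc k) few = ≤-trans (+-mono-≤ ≤-refl (+-mono-≤
          (∑-prob≤ as mE k mG₁ λ ω (g , e) → ℕₚ.≤-pred (subst (ℕ._≤ suc k) (count-yes as e) (few ω g)))
          (few₂ (suc k) few)))
        (≤-reflexive (solve 3 (λ k p q → p :+ (k :* p :+ (:1 :+ k) :* q) := (:1 :+ k) :* (p :+ q))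
          refl (fromℕ k) (prob G₁) (prob G₂)))

    -- The expected number of events that occur is at most the expectation of N. On the layer N = k
    -- the events have total probability at most k times that of the layer, and the layers add up to
    -- the two sides.
    ∑-prob≤𝔼 : ∀ {A : Set} (as : List A) {E : A → Pred Ω 0ℓ} → (∀ a → Event (E a)) →
               {N : Ω → ℕ} → (∀ k → Event (N ⊢ (_≡ k))) →
               (∀ ω → count (λ a → E a ω) as ℕ.≤ N ω) → fin (∑ as (prob ∘ E)) ≤∞ 𝔼 N
    ∑-prob≤𝔼 {A} as {E} mE {N} mN few = below
      where
      term : ℕ → ℝ
      term k = fromℕ k * prob (N ⊢ (_≡ k))
      piece : A → ℕ → ℝ
      piece a k = prob (E a ∩ (N ⊢ (_≡ k)))
      0≤piece : ∀ a k → 0# ≤ piece a k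
      0≤piece a k = nonNeg (∩-event (mE a) (mN k))
      piece-lub : ∀ a → IsLub (Range (λ n → ∑< n (piece a))) (prob (E a))
      piece-lub a = subst (IsLub _) (sym (cong-≐ (mE a) ((λ {ω} e → N ω , e , refl) , λ (_ , e , _) → e)))
        (additive {A = λ k → E a ∩ (N ⊢ (_≡ k))} (λ k → ∩-event (mE a) (mN k))
          λ { i≢j ((_ , refl) , (_ , refl)) → i≢j refl })
      lub : ∀ as → IsLub (Range (λ n → ∑ as (λ a → ∑< n (piece a)))) (∑ as (prob ∘ E))
      lub []       = (λ { _ (_ , refl) → ≤-refl }) , λ s us → us _ (0 , refl)
      lub (a ∷ as) = IsLub-+ (∑<-monotone (0≤piece a))
        (λ m n m≤n → ∑-mono as λ a → ∑<-monotone (0≤piece a) m n m≤n) (piece-lub a) (lub as)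
      least : ∀ {b} → IsUpperBound (Range (λ n → ∑< n term)) b → ∑ as (prob ∘ E) ≤ b
      least ub = proj₂ (lub as) _ λ { _ (n , refl) → ≤-trans (≤-reflexive (∑-∑< as n piece))
        (≤-trans (∑<-mono n λ k → ∑-prob≤ as mE k (mN k) λ { ω refl → few ω }) (ub _ (n , refl))) }
      below : fin (∑ as (prob ∘ E)) ≤∞ ∑∞ term
      below with em {∃ (IsUpperBound (Range (λ n → ∑< n term)))}
      ... | yes ub = fin≤fin (least (proj₁ (sup-isLub (_ , 0 , refl) ub)))
      -- A divergent series means infinite expectation.
      ... | no _   = ≤top

  -- Fair coins flipped depending on the points.

  flipBits : (ℝ → Bool) → ∀ {n} → Vec ℝ n → Vec Bool n → Vec Bool n
  flipBits s = zipWith (λ x b → s x xor b)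

  flipBits-involutive : ∀ s {n} (xs : Vec ℝ n) v → flipBits s xs (flipBits s xs v) ≡ v
  flipBits-involutive s []       []      = refl
  flipBits-involutive s (x ∷ xs) (b ∷ v) = cong₂ _∷_
    (trans (sym (Boolₚ.xor-assoc (s x) (s x) b)) (cong (_xor b) (Boolₚ.xor-same (s x))))
    (flipBits-involutive s xs v)

  half≡1-half : 1# - ½ ≡ ½
  half≡1-half = trans (cong (_- ½) (sym (*-inverse (fromℕ 2) (λ e → proj₂ (0<fromℕ 1) (sym e)))))
    (solve 1 (λ i → (:1 :+ (:1 :+ :0)) :* i :- :1 :* i := :1 :* i) refl (fromℕ 2 ⁻¹))

  -- At outlier chance 1/2 all patterns have the same weight, so a bijection of the patterns, even
  -- one that varies with the points, preserves their law.
  bernoulli-½ : ∀ {n} (o : Vec Bool n) → bernoulli ½ o ≡ ½ ^ n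
  bernoulli-½ []          = refl
  bernoulli-½ (true ∷ o)  = cong (½ *_) (bernoulli-½ o)
  bernoulli-½ (false ∷ o) = cong₂ _*_ half≡1-half (bernoulli-½ o)

  module _ {n} (E : Experiment ½ n) where
    open Experiment E

    rest : Ω → Vec ℝ n × Carrier Seed
    rest ω = points ω , seed ω

    Rest : MeasurableSpace
    Rest = Vecᵐ Borel n ⊗ Seed

    rest-measurable : IsMeasurable space Rest rest
    rest-measurable = pair-measurable space {Vecᵐ Borel n} {Seed} points-meas seed-meas

    -- The flip is an involution, so it yields b exactly when the coins are
    -- the flip of b, which has conditional probability 2^-n given the rest.
    flip-law : ∀ {s} → (∀ b → IsMeasurable Borel Boolᵐ (λ x → s x xor b)) →
      ∀ {A : Vec Bool n → Pred (Vec ℝ n × Carrier Seed) 0ℓ} → (∀ v → Measurable Rest (A v)) →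
      Event (λ ω → A (flipBits s (points ω) (outlier ω)) (rest ω)) →
      prob (λ ω → A (flipBits s (points ω) (outlier ω)) (rest ω)) ≡ ∑ᵇ n (λ v → ½ ^ n * prob (rest ⊢ A v))
    flip-law {s} ms {A} mA e = trans (partition probabilitySpace g-bits e) (∑ᵇ-cong n each)
      where
      P = probabilitySpace
      g : Ω → Vec Bool n
      g ω = flipBits s (points ω) (outlier ω)
      flip-measurable : ∀ {M xs o} → IsMeasurable M (Vecᵐ Borel n) xs → Bits M o →
        Bits M (λ ω → flipBits s (xs ω) (o ω))
      flip-measurable {M} mxs mo = bits M (zipWith-measurable M {Boolᵐ} (λ x b → s x xor b) mxs mo ms)
      const-bits : ∀ M (v : Vec Bool n) → Bits M (λ _ → v)
      const-bits M v i b = const-measurable M (lookup v i ≡ b)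
      g-bits : Bits space g
      g-bits = flip-measurable {space} points-meas (bits space outlier-meas)
      swap : ∀ xs {v b} → flipBits s xs v ≡ b → flipBits s xs b ≡ v
      swap xs refl = flipBits-involutive s xs _
      -- For fixed outliers v, the equation that the flip of v is b becomes a condition on the
      -- points alone. This separates the event into one about `outlier` and one about `rest`, as
      -- independence requires.
      F : Vec Bool n → Vec Bool n → Pred (Vec ℝ n × Carrier Seed) 0ℓ
      F b v = A b ∩ λ (xs , _) → flipBits s xs b ≡ v
      points-of-rest : IsMeasurable Rest (Vecᵐ Borel n) proj₁
      points-of-rest mB = base (fst mB)
      F-measurable : ∀ b v → Measurable Rest (F b v)
      F-measurable b v = ∩-measurable Rest (mA b)
        (bits-≡ Rest (flip-measurable {Rest} points-of-rest (const-bits Rest b)) v)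
      outlier≡-measurable : ∀ v → Measurable (Vecᵐ Boolᵐ n) (_≡ v)
      outlier≡-measurable = bits-≡ (Vecᵐ Boolᵐ n) (λ i b → base (coord i (base (singleton b))))
      each : ∀ b → prob ((λ ω → A (g ω) (rest ω)) ∩ (g ⊢ (_≡ b))) ≡ ½ ^ n * prob (rest ⊢ A b)
      each b = begin
        prob ((λ ω → A (g ω) (rest ω)) ∩ (g ⊢ (_≡ b)))
          ≡⟨ cong-≐ (∩-event P e (bits-≡ space g-bits b))
              ((λ { (a , refl) → a , refl }) , λ { (a , refl) → a , refl }) ⟩
        prob ((rest ⊢ A b) ∩ (g ⊢ (_≡ b)))
          ≡⟨ partition P (bits space outlier-meas) G-event ⟩
        ∑ᵇ n (λ v → prob (((rest ⊢ A b) ∩ (g ⊢ (_≡ b))) ∩ (outlier ⊢ (_≡ v))))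
          ≡⟨ ∑ᵇ-cong n independent ⟩
        ∑ᵇ n (λ v → ½ ^ n * prob (rest ⊢ F b v))
          ≡⟨ ∑ᵇ-*ˡ n _ _ ⟩
        ½ ^ n * ∑ᵇ n (λ v → prob (rest ⊢ F b v))
          ≡⟨ cong (½ ^ n *_) (partition P (flip-measurable {space} points-meas (const-bits space b))
              (rest-measurable (mA b))) ⟨
        ½ ^ n * prob (rest ⊢ A b) ∎
        where
        open ≡-Reasoning
        G-event : Event ((rest ⊢ A b) ∩ (g ⊢ (_≡ b)))
        G-event = ∩-event P (rest-measurable (mA b)) (bits-≡ space g-bits b)
        independent : ∀ v → prob (((rest ⊢ A b) ∩ (g ⊢ (_≡ b))) ∩ (outlier ⊢ (_≡ v))) ≡
          ½ ^ n * prob (rest ⊢ F b v)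
        independent v = trans
          (cong-≐ (∩-event P G-event (bits-≡ space (bits space outlier-meas) v))
            ( (λ { {ω} ((a , e₁) , refl) → refl , a , swap (points ω) e₁ })
            , λ { {ω} (refl , a , e₁) → (a , swap (points ω) e₁) , refl }))
          (trans (outlier⊥rest (outlier≡-measurable v) (F-measurable b v))
            (cong (_* prob (rest ⊢ F b v)) (trans (outlier-law v) (bernoulli-½ v))))

-- The adversary, and the bound on the list size.

module LowerBound (em : ExcludedMiddle 0ℓ) (R : CompleteOrderedField) where
  open Regression em R
  open Reals em R
  open Polynomials em R
  open Families em R
  open Construction em R
  open Measurability em R
  open Probability em R
  open MeasurableSpace using (Carrier; Measurable)

  count-≡0 : ∀ {A : Set} {P : A → Set} {as} → All (λ a → ¬ P a) as → count P as ≡ 0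
  count-≡0 []                 = refl
  count-≡0 {as = _ ∷ as} (¬p ∷ ¬ps) = trans (count-no as ¬p) (count-≡0 ¬ps)

  count-≤1 : ∀ {A : Set} {P : A → Set} {as} → AllPairs (λ a b → ¬ (P a × P b)) as → count P as ℕ.≤ 1
  count-≤1 [] = z≤n
  count-≤1 {P = P} {a ∷ as} (far ∷ fars) with em {P a}
  ... | yes p = s≤s (ℕₚ.≤-reflexive (count-≡0 (All.map (λ n q → n (p , q)) far)))
  ... | no _  = count-≤1 fars

  count-∷ : ∀ {A B : Set} {Q : A → B → Set} {b bs} as →
    count (λ a → Any (Q a) (b ∷ bs)) as ℕ.≤ count (λ a → Q a b) as ℕ.+ count (λ a → Any (Q a) bs) as
  count-∷ [] = z≤n
  count-∷ {Q = Q} {b} {bs} (a ∷ as) with em {Any (Q a) (b ∷ bs)} | em {Q a b} | em {Any (Q a) bs}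
  ... | no _          | yes _ | yes _ = ℕₚ.m≤n⇒m≤1+n (ℕₚ.≤-trans (count-∷ as) (ℕₚ.+-monoʳ-≤ _ (ℕₚ.n≤1+n _)))
  ... | no _          | yes _ | no _  = ℕₚ.m≤n⇒m≤1+n (count-∷ as)
  ... | no _          | no _  | yes _ = ℕₚ.≤-trans (count-∷ as) (ℕₚ.+-monoʳ-≤ _ (ℕₚ.n≤1+n _))
  ... | no _          | no _  | no _  = count-∷ as
  ... | yes _         | yes _ | yes _ = s≤s (ℕₚ.≤-trans (count-∷ as) (ℕₚ.+-monoʳ-≤ _ (ℕₚ.n≤1+n _)))
  ... | yes _         | yes _ | no _  = s≤s (count-∷ as)
  ... | yes _         | no _  | yes _ = ℕₚ.≤-trans (s≤s (count-∷ as)) (ℕₚ.≤-reflexive (sym (ℕₚ.+-suc _ _)))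
  ... | yes (here x)  | no ¬x | no _  = ⊥-elim (¬x x)
  ... | yes (there x) | no _  | no ¬x = ⊥-elim (¬x x)

  -- Each list element b accounts for at most one a, since no two of the a share a b.
  count-Any≤length : ∀ {A B : Set} {Q : A → B → Set} {as} →
    (∀ b → AllPairs (λ a a′ → ¬ (Q a b × Q a′ b)) as) → ∀ bs → count (λ a → Any (Q a) bs) as ℕ.≤ length bs
  count-Any≤length {as = as} far []       = ℕₚ.≤-reflexive (count-≡0 (All.universal (λ _ ()) as))
  count-Any≤length {as = as} far (b ∷ bs) = ℕₚ.≤-trans (count-∷ as)
    (ℕₚ.+-mono-≤ (count-≤1 (far b)) (count-Any≤length far bs))

  Near : ℝ → Poly → Poly → Set
  Near r p q = ‖ (λ x → eval q x - eval p x) ‖∞ ≤ r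

  -- Polynomials are bounded on [-1,1], so the norm is a genuine supremum and not the default value
  -- 0 of `sup`.
  near-pointwise : ∀ {r p q} → Near r p q → ∀ x → In[-1,1] x → Within r (eval q x - eval p x)
  near-pointwise {r} {p} {q} near x x-in = ∣∣≤-half (≤-trans (proj₁ isLub _ (x , x-in , refl)) near)
    where
    b = proj₁ (eval-bounded p)
    b′ = proj₁ (eval-bounded q)
    neg : ∀ {c z} → Within c z → Within c (- z)
    neg {c} {z} (l , r) = r , ≤-trans (≤-reflexive (solve 1 (λ z → :- (:- z) := z) refl z)) l
    isLub : IsLub _ ‖ (λ x → eval q x - eval p x) ‖∞
    isLub = sup-isLub (_ , x , x-in , refl) (b′ + b , λ { _ (y , y-in , refl) →
      let (l , r) = within-+ (proj₂ (eval-bounded q) y y-in) (neg (proj₂ (eval-bounded p) y y-in)) in ∣∣≤ l r })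

  apart⇒¬near : ∀ {r M p p′ q} → (1# + 1#) * r < M → (∃ λ z → In[-1,1] z × eval p z - eval p′ z ≡ M) →
                ¬ (Near r p q × Near r p′ q)
  apart⇒¬near {r} {M} {p} {p′} {q} gap (z , z-in , refl) (near , near′) = <⇒≱ gap
    (slack (0≤+ (≤⇒0≤ (proj₂ (near-pointwise {p = p} {q} near z z-in)))
      (≤⇒0≤ (proj₁ (near-pointwise {p = p′} {q} near′ z z-in))))
      (solve 4 (λ r p p′ q → (:1 :+ :1) :* r :- (p :- p′) := r :- :- (q :- p) :+ (r :- (q :- p′)))
        refl r (eval p z) (eval p′ z) (eval q z)))

  ≤-length*⇒≤∑ : ∀ {A : Set} {f : A → ℝ} {c as} → All (λ a → c ≤ f a) as → c * fromℕ (length as) ≤ ∑ as f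
  ≤-length*⇒≤∑ {c = c} [] = ≤-reflexive (zeroʳ c)
  ≤-length*⇒≤∑ {c = c} {a ∷ as} (p ∷ ps) = ≤-trans
    (≤-reflexive (solve 2 (λ c l → c :* (:1 :+ l) := c :+ c :* l) refl c (fromℕ (length as))))
    (+-mono-≤ p (≤-length*⇒≤∑ ps))

  ≤-≤∞-trans : ∀ {x y z} → x ≤ y → fin y ≤∞ z → fin x ≤∞ z
  ≤-≤∞-trans p (fin≤fin q) = fin≤fin (≤-trans p q)
  ≤-≤∞-trans p ≤top        = ≤top

  two-steps : ∀ {u v w} → u ≤ w → w ≤ u + 1# → Within 1# (v - w) → ∣ u - v ∣ ≤ 1# + 1#
  two-steps {u} {v} {w} lo hi (below , above) = ∣∣≤
    (slack (0≤+ (0≤+ (≤⇒0≤ lo) 0≤1) (≤⇒0≤ above))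
      (solve 3 (λ u v w → :1 :+ :1 :- (u :- v) := w :- u :+ :1 :+ (:1 :- :- (v :- w))) refl u v w))
    (slack (0≤+ (≤⇒0≤ hi) (≤⇒0≤ below))
      (solve 3 (λ u v w → :1 :+ :1 :- (:- (u :- v)) := u :+ :1 :- w :+ (:1 :- (v :- w))) refl u v w))

  module Confusion {d m M} (family : Family d m M) (ρ : Rounding (Family.polys family)) where
    open Family family
    open Rounding ρ

    -- One unit for the width of the bands and one for the rounding of the point.
    σ₀ : ℝ
    σ₀ = 1# + 1#

    TwoValuedAt : ℝ → ℝ → Set
    TwoValuedAt x u = All (λ p → (0# ≤ eval p x × eval p x ≤ 1#) ⊎ (u ≤ eval p x × eval p x ≤ u + 1#)) polys

    level : ℝ → ℝ
    level x with em {In[-1,1] x}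
    ... | yes x-in = proj₁ (twoValued x x-in)
    ... | no _     = 0#

    level-twoValued : ∀ x → In[-1,1] x → TwoValuedAt x (level x)
    level-twoValued x x-in with em {In[-1,1] x}
    ... | yes x-in′ = proj₂ (twoValued x x-in′)
    ... | no ¬x-in  = ⊥-elim (¬x-in x-in)

    -- The point enters only through `round`, which makes this measurable although `level` comes
    -- from an existential.
    value : ℝ → Bool → ℝ
    value x b = if b then level (round x) else 0#

    High : Poly → ℝ → Set
    High p x = level x ≤ eval p x × eval p x ≤ level x + 1#

    side : Poly → ℝ → Bool
    side p x = does (em {High p (round x)})

    value-close : ∀ {p} → p ∈ polys → ∀ x → In[-1,1] x → ∣ value x (side p x) - eval p x ∣ ≤ σ₀
    value-close {p} p∈ x x-in = by-side (em {High p (round x)})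
      where
      near : Within 1# (eval p x - eval p (round x))
      near = All.lookup (close x x-in) p∈
      by-side : (high? : Dec (High p (round x))) →
        ∣ (if does high? then level (round x) else 0#) - eval p x ∣ ≤ σ₀
      by-side (yes (lo , hi)) = two-steps lo hi near
      by-side (no ¬high) = [ (λ (lo , hi) → two-steps lo (≤-trans hi (≤-reflexive (sym (+-identityˡ 1#)))) near)
        , (λ high → ⊥-elim (¬high high)) ]′ (All.lookup (level-twoValued (round x) (inside x x-in)) p∈)

    base-values : ∀ {n} → Vec ℝ n → Vec Bool n → Vec ℝ n
    base-values = zipWith value

    base-values-measurable : ∀ M {n} {xs : Carrier M → Vec ℝ n} {v} →
      IsMeasurable M (Vecᵐ Borel n) xs → Bits M v →
      IsMeasurable M (Vecᵐ Borel n) (λ ω → base-values (xs ω) (v ω))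
    base-values-measurable M mxs mv =
      zipWith-measurable M {Borel} value mxs mv λ b {B} _ → discrete (λ r → B (if b then level r else 0#))

    side-measurable : ∀ p b → IsMeasurable Borel Boolᵐ (λ x → side p x xor b)
    side-measurable p b {B} _ = discrete (λ r → B (does (em {High p r}) xor b))

    confused-values : Poly → ∀ {n} → Vec ℝ n × Vec Bool n → Vec ℝ n
    confused-values p (xs , o) = base-values xs (flipBits (side p) xs o)

    confused-values-measurable : ∀ p M {n} {xs : Carrier M → Vec ℝ n} {o} →
      IsMeasurable M (Vecᵐ Borel n) xs → Bits M o →
      IsMeasurable M (Vecᵐ Borel n) (λ ω → confused-values p (xs ω , o ω))
    confused-values-measurable p M mxs mo = base-values-measurable M mxs
      (bits M (zipWith-measurable M {Boolᵐ} (λ x b → side p x xor b) mxs mo (side-measurable p)))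

    -- An outlier reports the value on the other side, so each y is a fair
    -- coin flip between the two values whatever p is.
    adversary : ∀ {p} → p ∈ polys → ∀ n → Adversary p σ₀ n
    adversary {p} p∈ n = record
      { values      = confused-values p
      ; values-meas = confused-values-measurable p XO (λ mB → base (fst mB))
          (bits XO (λ mB → base (snd mB)))
      ; inlier      = λ xs o xs-in i o-false → subst (λ y → ∣ y - eval p (lookup xs i) ∣ ≤ σ₀)
          (sym (trans (Vecₚ.lookup-zipWith value i xs _) (cong (value (lookup xs i))
            (trans (Vecₚ.lookup-zipWith _ i xs o)
              (trans (cong (side p (lookup xs i) xor_) o-false) (Boolₚ.xor-identityʳ _))))))
          (value-close p∈ (lookup xs i) (xs-in i))
      }
      where
      XO : MeasurableSpace
      XO = Vecᵐ Borel n ⊗ Vecᵐ Boolᵐ n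

    module _ {n} (E : Experiment ½ n) (alg : Algorithm n (Experiment.Seed E)) (r : ℝ) where
      open Experiment E
      open Algorithm alg

      -- Here p is the polynomial to be approximated. The one behind the samples has disappeared: it
      -- acts only through the bits, now the free argument v.
      Approximates : Poly → Vec Bool n → Pred (Vec ℝ n × Carrier Seed) 0ℓ
      Approximates p v (xs , w) = ContainsApprox (run σ₀ (zip xs (base-values xs v)) w) p r

      approximates-measurable : ∀ p v → Measurable (Rest E) (Approximates p v)
      approximates-measurable p v = pair-measurable (Rest E) {Vecᵐ (Borel ⊗ Borel) n} {Seed}
        (zip-measurable (Rest E) {Borel} {Borel} points-of-rest
          (base-values-measurable (Rest E) points-of-rest (λ i b → const-measurable (Rest E) (lookup v i ≡ b))))
        (λ mB → base (snd mB)) (approx-meas σ₀ p r)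
        where
        points-of-rest : IsMeasurable (Rest E) (Vecᵐ Borel n) proj₁
        points-of-rest mB = base (fst mB)

      answer : ∀ {p} → p ∈ polys → Ω → FinitePolySet
      answer p∈ = output E alg (adversary p∈ n)

      input-measurable : ∀ p → IsMeasurable space Input
        (λ ω → zip (points ω) (confused-values p (points ω , outlier ω)) , seed ω)
      input-measurable p = pair-measurable space {Vecᵐ (Borel ⊗ Borel) n} {Seed}
        (zip-measurable space {Borel} {Borel} points-meas
          (confused-values-measurable p space points-meas (bits space outlier-meas))) seed-meas

      answer-event : ∀ {p} (p∈ : p ∈ polys) q → Event (λ ω → ContainsApprox (answer p∈ ω) q r)
      answer-event {p} p∈ q = input-measurable p (approx-meas σ₀ q r)

      -- Both sides equal the same average over uniform bits v, in which neither p nor p′ occurs.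
      answer-law : ∀ {p p′} (p∈ : p ∈ polys) (p′∈ : p′ ∈ polys) q →
        prob (λ ω → ContainsApprox (answer p∈ ω) q r) ≡ prob (λ ω → ContainsApprox (answer p′∈ ω) q r)
      answer-law {p} {p′} p∈ p′∈ q = trans (law p∈) (sym (law p′∈))
        where
        law : ∀ {p} (p∈ : p ∈ polys) → prob (λ ω → ContainsApprox (answer p∈ ω) q r) ≡
              ∑ᵇ n (λ v → ½ ^ n * prob (rest E ⊢ Approximates q v))
        law {p} p∈ = flip-law E {side p} (side-measurable p) (approximates-measurable q) (answer-event p∈ q)

      -- The success probability of each member under its own adversary is carried over to the
      -- single adversary for p. There the success events are counted together, and at most |L| of
      -- them occur at once.
      expectedSize-bound : (1# + 1#) * r < M →
        (∀ {p} (p∈ : p ∈ polys) → ¾ ≤ prob (λ ω → ContainsApprox (answer p∈ ω) p r)) →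
        ∀ {p} (p∈ : p ∈ polys) → fin (¾ * fromℕ (length polys)) ≤∞ expectedSize E alg (adversary p∈ n)
      expectedSize-bound gap success {p} p∈ = ≤-≤∞-trans
        (≤-length*⇒≤∑ (All.tabulate λ {q} q∈ → ≤-trans (success q∈) (≤-reflexive (answer-law q∈ p∈ q))))
        (∑-prob≤𝔼 probabilitySpace polys (answer-event p∈) (λ k → input-measurable p (card-meas σ₀ k))
          λ ω → count-Any≤length (λ q → AllPairs.map (λ {p₁} {p₂} → apart⇒¬near {p = p₁} {p₂} {q} gap) apart)
                  (elements (answer p∈ ω)))

  nonempty : ∀ {A : Set} (as : List A) m → length as ≡ 2 ℕ.^ m → ∃ (_∈ as)
  nonempty []       m e = ⊥-elim (ℕₚ.n≮0 (subst (m ℕ.<_) (sym e) (n<2^n m)))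
  nonempty (a ∷ as) m e = a , here refl

  lower-bound : ∀ d C → 1# ≤ C → ∀ n (E : Experiment ½ n) (alg : Algorithm n (Experiment.Seed E)) →
    (∀ p → Degree≤ d p → ∀ σ → 0# < σ → (adv : Adversary p σ n) → ¾ ≤ successProbability E C alg adv) →
    Σ Poly λ p → Σ ℝ λ σ → Σ (Adversary p σ n) λ adv →
      Degree≤ d p × 0# < σ × fin (¾ * (2^ ((rate * fromℕ d) / (√ C)))) ≤∞ expectedSize E alg adv
  lower-bound d C 1≤C n E alg succeeds =
    proj₁ member , σ₀ , adversary (proj₂ member) n , All.lookup degrees (proj₂ member) , 0<2 ,
    ≤-≤∞-trans (*-monoˡ-≤ ¾ 0≤¾ (≤-trans (2^≤ m large)
        (≤-reflexive (trans (sym (fromℕ-^ 2 m)) (cong fromℕ (sym size))))))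
      (expectedSize-bound E alg (C * σ₀) gap
        (λ p∈ → succeeds _ (All.lookup degrees p∈) σ₀ 0<2 (adversary p∈ n)) (proj₂ member))
    where
    open Parameters (parameters d C 1≤C)
    open Family family
    open Confusion family (rounding polys)
    -- Any member can serve as the true polynomial, since all of them produce the same law.
    member = nonempty polys m size
    0≤¾ : 0# ≤ ¾
    0≤¾ = *-nonNeg (0≤fromℕ 3) (0≤⁻¹ (0<fromℕ 3))

theorem5p8 : (em : ExcludedMiddle 0ℓ) (R : CompleteOrderedField) →
  let open Regression em R in
  Σ ℝ λ c → 0# < c ×
    (∀ (d : ℕ) → 1 ℕ.≤ d → ∀ (C : ℝ) → 1# ≤ C →
     ∀ (n : ℕ) (E : Experiment ½ n) (alg : Algorithm n (Experiment.Seed E)) →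
     (∀ (p : Poly) → Degree≤ d p → ∀ (σ : ℝ) → 0# < σ →
      ∀ (adv : Adversary p σ n) → ¾ ≤ successProbability E C alg adv) →
     Σ Poly λ p → Σ ℝ λ σ → Σ (Adversary p σ n) λ adv →
       Degree≤ d p × 0# < σ ×
       fin (¾ * (2^ ((c * fromℕ d) / (√ C)))) ≤∞ expectedSize E alg adv)
theorem5p8 em R =
  Construction.rate em R , Construction.0<rate em R , λ d _ → LowerBound.lower-bound em R d
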